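{- Let $\mathcal{G}$ be a finite triangulation of the sphere, with vertex set $V$, whose faces are properly $2$-coloured black and white (no two faces of the same colour share an edge). Let $W$ be the set of white triangles and $B$ the set of black triangles. Let $\mathcal{A}_W$ be the abelian group with generating set $V$ subject to the relations $r+c+s=0$ for every white triangle with vertex set $\{r,c,s\}$, and let $\mathcal{A}_B$ be the abelian group with generating set $V$ subject to the relations $r+c+s=0$ for every black triangle with vertex set $\{r,c,s\}$. Then $\mathcal{A}_W\cong\mathcal{A}_B$.
   Context: A triangulation of the sphere is a $2$-cell embedding of a finite graph (multiple edges allowed, no loops) in the sphere in which every face is bounded by a $3$-cycle; each triangle has three distinct incident vertices. Two triangles of different colours may have the same vertex set; a triangle is determined by its colour and its vertex set. -}

module Defs where

open import Data.Nat using (ℕ; zero; suc) renaming (_+_ to _+ℕ_; _*_ to _*ℕ_)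
open import Data.Fin using (Fin; zero; suc; _≟_)
open import Data.Integer using (ℤ; _+_; _-_; _*_; 0ℤ; 1ℤ)
open import Data.Bool using (Bool; true; false; if_then_else_)
open import Data.Product using (Σ; ∃; _×_; _,_)
open import Relation.Binary.PropositionalEquality using (_≡_; _≢_)
open import Relation.Nullary using (¬_)
open import Relation.Nullary.Decidable using (⌊_⌋)
open import Function using (_∘_)

iterate : {A : Set} → (A → A) → ℕ → A → A
iterate f zero    x = x
iterate f (suc k) x = f (iterate f k x)

SameOrbit : {d : ℕ} → (Fin d → Fin d) → Fin d → Fin d → Set
SameOrbit p x y = ∃ λ k → iterate p k x ≡ y

data Reach {d : ℕ} (σ α : Fin d → Fin d) (x : Fin d) : Fin d → Set where
  here  : Reach σ α x x
  stepσ : ∀ {y} → Reach σ α x y → Reach σ α x (σ y)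
  stepα : ∀ {y} → Reach σ α x y → Reach σ α x (α y)

-- A finite triangulation of the sphere, given as a connected orientable
-- combinatorial map of genus 0 (Euler characteristic 2) whose faces are all
-- triangles and which has no loops, together with a proper 2-colouring of
-- its faces.  Darts: Fin darts.  α: edge involution, σ: rotation at
-- vertices, φ = σ ∘ α: face permutation.  Vertices are the σ-orbits,
-- labelled by vtx : Fin darts → Fin nV (bijectively on orbits); faces are the
-- φ-orbits, labelled by face : Fin darts → Fin nF.  Edges are α-orbits,
-- of which there are darts/2.
record ColouredSphereTriangulation (nV : ℕ) : Set where
  field
    darts : ℕ
    nF    : ℕ
    α σ σ⁻¹ : Fin darts → Fin darts
    α-invol    : ∀ x → α (α x) ≡ x
    α-fpf      : ∀ x → α x ≢ x
    σ-left     : ∀ x → σ⁻¹ (σ x) ≡ x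
    σ-right    : ∀ x → σ (σ⁻¹ x) ≡ x
    vtx        : Fin darts → Fin nV
    vtx-surj   : ∀ v → ∃ λ x → vtx x ≡ v
    vtx-orbit  : ∀ x y → vtx x ≡ vtx y → SameOrbit σ x y
    orbit-vtx  : ∀ x y → SameOrbit σ x y → vtx x ≡ vtx y
    face       : Fin darts → Fin nF
    face-surj  : ∀ t → ∃ λ x → face x ≡ t
    face-orbit : ∀ x y → face x ≡ face y → SameOrbit (σ ∘ α) x y
    orbit-face : ∀ x y → SameOrbit (σ ∘ α) x y → face x ≡ face y
    triangular : ∀ x → iterate (σ ∘ α) 3 x ≡ x
    nontrivial : ∀ x → (σ ∘ α) x ≢ x
    no-loops   : ∀ x → vtx (α x) ≢ vtx x
    connected  : ∀ x y → Reach σ α x y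
    -- Euler's formula V - E + F = 2 with E = darts/2
    euler      : 2 *ℕ nV +ℕ 2 *ℕ nF ≡ darts +ℕ 4
    -- proper 2-colouring of faces (true = white, false = black)
    colour     : Fin nF → Bool
    proper     : ∀ x → colour (face x) ≢ colour (face (α x))

-- Abelian groups presented by generators Fin n, as ℤ^n modulo the
-- subgroup generated by a family of relation vectors.

Vec : ℕ → Set
Vec n = Fin n → ℤ

_⊕_ : ∀ {n} → Vec n → Vec n → Vec n
(x ⊕ y) i = x i + y i

_⊖_ : ∀ {n} → Vec n → Vec n → Vec n
(x ⊖ y) i = x i - y i

unit : ∀ {n} → Fin n → Vec n
unit i j = if ⌊ i ≟ j ⌋ then 1ℤ else 0ℤ

sumFin : ∀ {m} → (Fin m → ℤ) → ℤ
sumFin {zero}  f = 0ℤ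
sumFin {suc m} f = f zero + sumFin (f ∘ suc)

InSpan : ∀ {n m} → (Fin m → Vec n) → Vec n → Set
InSpan {n} {m} rel x = ∃ λ (c : Fin m → ℤ) → ∀ j → x j ≡ sumFin (λ i → c i * rel i j)

Eq : ∀ {n m} → (Fin m → Vec n) → Vec n → Vec n → Set
Eq rel x y = InSpan rel (x ⊖ y)

record PresIso {n m k : ℕ} (R : Fin m → Vec n) (S : Fin k → Vec n) : Set where
  field
    to     : Vec n → Vec n
    from   : Vec n → Vec n
    to-cong   : ∀ x y → Eq R x y → Eq S (to x) (to y)
    from-cong : ∀ x y → Eq S x y → Eq R (from x) (from y)
    to-hom    : ∀ x y → Eq S (to (x ⊕ y)) (to x ⊕ to y)
    from-hom  : ∀ x y → Eq R (from (x ⊕ y)) (from x ⊕ from y)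
    from-to   : ∀ x → Eq R (from (to x)) x
    to-from   : ∀ y → Eq S (to (from y)) y

-- The relations r + c + s = 0 for the triangles of a given colour.
-- Indexed by darts: dart x contributes the relation of its face
-- (vertices vtx x, vtx (φ x), vtx (φ² x)) if that face has colour b,
-- and the zero vector otherwise.  (Each face occurs 3 times; repeats
-- and zero vectors do not change the generated subgroup.)

module _ {nV : ℕ} (T : ColouredSphereTriangulation nV) where
  open ColouredSphereTriangulation T

  φ : Fin darts → Fin darts
  φ = σ ∘ α

  triangleRel : Bool → Fin darts → Vec nV
  triangleRel b x =
    if ⌊ Data.Bool._≟_ (colour (face x)) b ⌋
    then unit (vtx x) ⊕ (unit (vtx (φ x)) ⊕ unit (vtx (φ (φ x))))
    else (λ _ → 0ℤ)

  whiteRels : Fin darts → Vec nV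
  whiteRels = triangleRel true

  blackRels : Fin darts → Vec nV
  blackRels = triangleRel false

{-# OPTIONS --safe #-}
-- Write N_b for the matrix whose rows are the relations of colour b, padded by
-- two zero rows; by Euler's formula it is square, of size |V|. Diagonalising N_b
-- gives coker N_b ≅ coker N_bᵀ. Sending the face generators to the sums of their
-- vertices, and the two generators of the zero rows to the ends of an edge,
-- defines a map from coker N_bᵀ to the group of the other colour: it respects the
-- relations because the Gram matrices N_bᵀ N_b of the two colours agree, and it is
-- onto because any two triangles are joined by a chain of triangles in which
-- consecutive ones share an edge. So each of the two groups maps onto the other,
-- and finitely generated abelian groups are Hopfian.
module Submission where

open import Defs hiding (φ)
open import Data.Nat as ℕ using (ℕ; zero; suc)
import Data.Nat.Properties as ℕ
import Data.Nat.Divisibility as ℕ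
open import Data.Nat.Induction using (<-wellFounded)
open import Data.Nat.Tactic.RingSolver using () renaming (solve-∀ to ℕ-solve-∀)
open import Data.Bool using (Bool; true; false; not; if_then_else_)
import Data.Bool as Bool
import Data.Bool.Properties as Bool
open import Data.Fin using (Fin; zero; suc; _≟_; toℕ; fromℕ<; combine; remQuot; punchOut)
open import Data.Fin.Properties
  using (any?; toℕ<n; toℕ-injective; toℕ-fromℕ<; punchOut-injective; injective⇒≤;
         combine-injective; combine-remQuot)
open import Data.Fin.Permutation.Components using (transpose; transpose-inverse)
open import Data.Integer
  using (ℤ; _+_; _-_; _*_; -_; 0ℤ; 1ℤ; -1ℤ; ∣_∣; NonZero; ≢-nonZero)
import Data.Integer as ℤ
import Data.Integer.Properties as ℤ
open import Data.Integer.DivMod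
  using (_%_; _/_; a≡a%n+[a/n]*n; n%d<d; _%ℕ_; _/ℕ_; a≡a%ℕn+[a/ℕn]*n; n%ℕd<d)
open import Data.Integer.Divisibility.Signed
  using (_∣_; divides; _∣?_; ∣-refl; ∣-trans; ∣ᵤ⇒∣; ∣⇒∣ᵤ; 0∣⇒≡0;
         ∣m∣n⇒∣m+n; ∣n⇒∣m*n; ∣m⇒∣m*n; ∣m∣∣m; m∣∣m∣)
open import Data.Integer.Tactic.RingSolver using (solve-∀)
open import Data.Product using (∃; _×_; _,_; proj₁; proj₂)
open import Data.Sum using (_⊎_; inj₁; inj₂)
open import Function using (_∘_)
open import Function.Definitions using (Injective)
open import Induction.WellFounded using (Acc; acc)
open import Relation.Binary using (IsEquivalence)
open import Relation.Binary.PropositionalEquality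
open import Relation.Nullary using (¬_; Dec; yes; no; contradiction)
open import Relation.Nullary.Decidable using (⌊_⌋; ¬?; decidable-stable)
open import Relation.Unary using (Decidable)

open ≡-Reasoning

-- Integer matrices

-- The Gram matrices agree for a local reason. At distinct vertices `u` and `v` the entry counts the
-- edges joining them, and each edge borders one triangle of each colour; on the diagonal it counts
-- the triangles of one colour at a vertex, and colours alternate around a vertex. A relation of
-- coker N_bᵀ is the star of a vertex v, the sum of the faces of colour b at v. Its image is row v
-- of N_bᵀ N_b, which equals row v of the Gram matrix of the other colour and is therefore a
-- combination of triangles of that colour. The transpose enters because this map starts from a
-- group generated by faces, whereas both groups of the theorem are generated by vertices. The
-- passage from coker N_b to coker N_bᵀ depends on a chosen diagonal form, so the resulting
-- surjections for the two colours have no reason to be inverse to each other. Hence injectivity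
-- comes from a general property of finitely generated abelian groups, and the inverse is read off
-- from chosen preimages.

sum-cong : ∀ {n} {f g : Vec n} → f ≗ g → sumFin f ≡ sumFin g
sum-cong {zero}  e = refl
sum-cong {suc n} e = cong₂ _+_ (e zero) (sum-cong (e ∘ suc))

sum-zero : ∀ n → sumFin {n} (λ _ → 0ℤ) ≡ 0ℤ
sum-zero zero    = refl
sum-zero (suc n) = trans (ℤ.+-identityˡ _) (sum-zero n)

sum-+ : ∀ {n} (f g : Vec n) → sumFin (f ⊕ g) ≡ sumFin f + sumFin g
sum-+ {zero}  f g = refl
sum-+ {suc n} f g = trans (cong (_+_ (f zero + g zero)) (sum-+ (f ∘ suc) (g ∘ suc)))
  (interchange (f zero) (g zero) _ _)
  where
  interchange : ∀ a b c d → a + b + (c + d) ≡ a + c + (b + d)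
  interchange = solve-∀

sum-*ˡ : ∀ {n} a (f : Vec n) → sumFin (λ i → a * f i) ≡ a * sumFin f
sum-*ˡ {zero}  a f = sym (ℤ.*-zeroʳ a)
sum-*ˡ {suc n} a f = trans (cong (a * f zero +_) (sum-*ˡ a (f ∘ suc)))
  (sym (ℤ.*-distribˡ-+ a (f zero) _))

sum-*ʳ : ∀ {n} (f : Vec n) a → sumFin (λ i → f i * a) ≡ sumFin f * a
sum-*ʳ f a = trans (sum-cong (λ i → ℤ.*-comm (f i) a)) (trans (sum-*ˡ a f) (ℤ.*-comm a _))

sum-swap : ∀ {m n} (f : Fin m → Fin n → ℤ) →
  sumFin (λ i → sumFin (f i)) ≡ sumFin (λ j → sumFin (λ i → f i j))
sum-swap {zero}  {n} f = sym (sum-zero n)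
sum-swap {suc m} f = trans (cong (sumFin (f zero) +_) (sum-swap (f ∘ suc)))
  (sym (sum-+ (f zero) _))

unit-diag : ∀ {n} (i : Fin n) → unit i i ≡ 1ℤ
unit-diag i with i ≟ i
... | yes _   = refl
... | no  i≢i = contradiction refl i≢i

unit-off : ∀ {n} {i j : Fin n} → i ≢ j → unit i j ≡ 0ℤ
unit-off {i = i} {j} i≢j with i ≟ j
... | yes i≡j = contradiction i≡j i≢j
... | no  _   = refl

unit-suc : ∀ {n} (i j : Fin n) → unit (suc i) (suc j) ≡ unit i j
unit-suc i j with i ≟ j
... | yes _ = refl
... | no  _ = refl

unit-sym : ∀ {n} (i j : Fin n) → unit i j ≡ unit j i
unit-sym i j with i ≟ j
... | yes refl = sym (unit-diag i)
... | no  i≢j  = sym (unit-off (i≢j ∘ sym))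

sum-unit : ∀ {n} (i : Fin n) (f : Vec n) → sumFin (λ k → unit i k * f k) ≡ f i
sum-unit {suc n} zero f = begin
  1ℤ * f zero + sumFin (λ k → 0ℤ * f (suc k))  ≡⟨ cong₂ _+_ (ℤ.*-identityˡ (f zero))
    (trans (sum-cong (λ k → ℤ.*-zeroˡ (f (suc k)))) (sum-zero n)) ⟩
  f zero + 0ℤ                                  ≡⟨ ℤ.+-identityʳ _ ⟩
  f zero                                       ∎
sum-unit (suc i) f = begin
  0ℤ * f zero + sumFin (λ k → unit (suc i) (suc k) * f (suc k))  ≡⟨ cong₂ _+_ (ℤ.*-zeroˡ (f zero))
    (sum-cong (λ k → cong (_* f (suc k)) (unit-suc i k))) ⟩
  0ℤ + sumFin (λ k → unit i k * f (suc k))                       ≡⟨ ℤ.+-identityˡ _ ⟩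
  sumFin (λ k → unit i k * f (suc k))                            ≡⟨ sum-unit i (f ∘ suc) ⟩
  f (suc i)                                                      ∎

-- Vectors are rows; a matrix is the family of its rows, so that
-- InSpan A x says that x ≗ c · A for some c.
Mat : ℕ → ℕ → Set
Mat m n = Fin m → Vec n

infixl 7 _·_ _⊗_
infix  8 _ᵀ
infix  4 _≈_

_≈_ : ∀ {m n} → Mat m n → Mat m n → Set
A ≈ B = ∀ i → A i ≗ B i

_·_ : ∀ {m n} → Vec m → Mat m n → Vec n
(x · A) j = sumFin (λ i → x i * A i j)

_⊗_ : ∀ {m n p} → Mat m n → Mat n p → Mat m p
(A ⊗ B) i = A i · B

_ᵀ : ∀ {m n} → Mat m n → Mat n m
(A ᵀ) i j = A j i

·-congˡ : ∀ {m n} {x y : Vec m} (A : Mat m n) → x ≗ y → x · A ≗ y · A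
·-congˡ A x≗y j = sum-cong (λ i → cong (_* A i j) (x≗y i))

·-congʳ : ∀ {m n} (x : Vec m) {A B : Mat m n} → A ≈ B → x · A ≗ x · B
·-congʳ x A≈B j = sum-cong (λ i → cong (x i *_) (A≈B i j))

·-assoc : ∀ {m n p} (x : Vec m) (A : Mat m n) (B : Mat n p) → x · A · B ≗ x · (A ⊗ B)
·-assoc x A B j = begin
  sumFin (λ k → sumFin (λ i → x i * A i k) * B k j)    ≡⟨ sum-cong (λ k → sym (sum-*ʳ (λ i → x i * A i k) (B k j))) ⟩
  sumFin (λ k → sumFin (λ i → x i * A i k * B k j))    ≡⟨ sum-swap (λ k i → x i * A i k * B k j) ⟩
  sumFin (λ i → sumFin (λ k → x i * A i k * B k j))    ≡⟨ sum-cong (λ i → trans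
    (sum-cong (λ k → ℤ.*-assoc (x i) (A i k) (B k j))) (sum-*ˡ (x i) (λ k → A i k * B k j))) ⟩
  sumFin (λ i → x i * sumFin (λ k → A i k * B k j))    ∎

·-identityʳ : ∀ {n} (x : Vec n) → x · unit ≗ x
·-identityʳ x j = trans
  (sum-cong (λ i → trans (ℤ.*-comm (x i) _) (cong (_* x i) (unit-sym i j))))
  (sum-unit j x)

·-⊕ : ∀ {m n} (x y : Vec m) (A : Mat m n) → (x ⊕ y) · A ≗ (x · A) ⊕ (y · A)
·-⊕ x y A j = trans (sum-cong (λ i → ℤ.*-distribʳ-+ (A i j) (x i) (y i))) (sum-+ (λ i → x i * A i j) (λ i → y i * A i j))

scale : ∀ {n} → ℤ → Vec n → Vec n
scale a x i = a * x i

·-scale : ∀ {m n} a (x : Vec m) (A : Mat m n) → scale a x · A ≗ scale a (x · A)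
·-scale a x A j = trans (sum-cong (λ i → ℤ.*-assoc a (x i) (A i j))) (sum-*ˡ a (λ i → x i * A i j))

⊗-congˡ : ∀ {m n p} {A A′ : Mat m n} (B : Mat n p) → A ≈ A′ → A ⊗ B ≈ A′ ⊗ B
⊗-congˡ B e i = ·-congˡ B (e i)

⊗-congʳ : ∀ {m n p} (A : Mat m n) {B B′ : Mat n p} → B ≈ B′ → A ⊗ B ≈ A ⊗ B′
⊗-congʳ A f i = ·-congʳ (A i) f

⊗-assoc : ∀ {m n p q} (A : Mat m n) (B : Mat n p) (C : Mat p q) → A ⊗ B ⊗ C ≈ A ⊗ (B ⊗ C)
⊗-assoc A B C i = ·-assoc (A i) B C

⊗-identityˡ : ∀ {m n} (A : Mat m n) → unit ⊗ A ≈ A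
⊗-identityˡ A i j = sum-unit i (λ k → A k j)

⊗-ᵀ : ∀ {m n p} (A : Mat m n) (B : Mat n p) → (A ⊗ B) ᵀ ≈ B ᵀ ⊗ A ᵀ
⊗-ᵀ A B i j = sum-cong (λ k → ℤ.*-comm (A j k) (B k i))

≈-trans : ∀ {m n} {A B C : Mat m n} → A ≈ B → B ≈ C → A ≈ C
≈-trans e f i j = trans (e i j) (f i j)

≈-sym : ∀ {m n} {A B : Mat m n} → A ≈ B → B ≈ A
≈-sym e i j = sym (e i j)

-- Unimodular matrices and diagonal forms

record Unimodular (n : ℕ) : Set where
  field
    mat inv : Mat n n
    mat-inv : mat ⊗ inv ≈ unit
    inv-mat : inv ⊗ mat ≈ unit

open Unimodular

unit-unimodular : ∀ n → Unimodular n
unit-unimodular n = record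
  { mat = unit ; inv = unit ; mat-inv = ⊗-identityˡ unit ; inv-mat = ⊗-identityˡ unit }

⊗-inverse : ∀ {n} {A A′ B B′ : Mat n n} → A ⊗ A′ ≈ unit → B ⊗ B′ ≈ unit →
  A ⊗ B ⊗ (B′ ⊗ A′) ≈ unit
⊗-inverse {A = A} {A′} {B} {B′} e f =
  ≈-trans (⊗-assoc A B (B′ ⊗ A′))
  (≈-trans (⊗-congʳ A (≈-trans (≈-sym (⊗-assoc B B′ A′))
                      (≈-trans (⊗-congˡ A′ f) (⊗-identityˡ A′))))
  e)

⊗-unimodular : ∀ {n} → Unimodular n → Unimodular n → Unimodular n
⊗-unimodular P Q = record
  { mat = mat P ⊗ mat Q
  ; inv = inv Q ⊗ inv P
  ; mat-inv = ⊗-inverse {A = mat P} {inv P} {mat Q} {inv Q} (mat-inv P) (mat-inv Q)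
  ; inv-mat = ⊗-inverse {A = inv Q} {mat Q} {inv P} {mat P} (inv-mat Q) (inv-mat P)
  }

ᵀ-inverse : ∀ {n} {A A′ : Mat n n} → A ⊗ A′ ≈ unit → A′ ᵀ ⊗ A ᵀ ≈ unit
ᵀ-inverse {A = A} {A′} e i j =
  trans (sym (⊗-ᵀ A A′ i j)) (trans (e j i) (unit-sym j i))

ᵀ-unimodular : ∀ {n} → Unimodular n → Unimodular n
ᵀ-unimodular P = record
  { mat = mat P ᵀ
  ; inv = inv P ᵀ
  ; mat-inv = ᵀ-inverse {A = inv P} {mat P} (inv-mat P)
  ; inv-mat = ᵀ-inverse {A = mat P} {inv P} (mat-inv P)
  }

diag : ∀ {n} → Vec n → Mat n n
diag d i j = d i * unit i j

diag-ᵀ : ∀ {n} (d : Vec n) → (diag d) ᵀ ≈ diag d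
diag-ᵀ d i j with i ≟ j
... | yes refl = cong (d i *_) (unit-diag i)
... | no  i≢j  = trans (cong (d j *_) (unit-off (i≢j ∘ sym)))
                       (trans (ℤ.*-zeroʳ (d j)) (sym (ℤ.*-zeroʳ (d i))))

-- Weaker than Smith normal form: the entries of `d` come in any order, with any sign, and may be
-- zero.
record Diagonalisation {n} (N : Mat n n) : Set where
  field
    P Q : Unimodular n
    d   : Vec n
    PNQ : mat P ⊗ N ⊗ mat Q ≈ diag d

open Diagonalisation

-- Transposition exchanges row and column operations, so the reduction only has to implement
-- operations on rows. The diagonal `d` stays literally the same, which later identifies the groups
-- of `N` and `N ᵀ`.
diagonalise-ᵀ : ∀ {n} {N : Mat n n} → Diagonalisation N → Diagonalisation (N ᵀ)
diagonalise-ᵀ {N = N} D = record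
  { P = ᵀ-unimodular (Q D)
  ; Q = ᵀ-unimodular (P D)
  ; d = d D
  ; PNQ = ≈-trans (⊗-assoc (Qm ᵀ) (N ᵀ) (Pm ᵀ))
          (≈-trans (⊗-congʳ (Qm ᵀ) (≈-sym (⊗-ᵀ Pm N)))
          (≈-trans (≈-sym (⊗-ᵀ (Pm ⊗ N) Qm))
          (≈-trans (λ i j → PNQ D j i) (diag-ᵀ (d D)))))
  }
  where
  Pm = mat (P D)
  Qm = mat (Q D)

diagonalise-row : ∀ {n} {N : Mat n n} (E : Unimodular n) →
  Diagonalisation (mat E ⊗ N) → Diagonalisation N
diagonalise-row {N = N} E D = record
  { P = ⊗-unimodular (P D) E
  ; Q = Q D
  ; d = d D
  ; PNQ = ≈-trans (⊗-congˡ (mat (Q D)) (⊗-assoc (mat (P D)) (mat E) N)) (PNQ D)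
  }

block : ∀ {n} → ℤ → Mat n n → Mat (suc n) (suc n)
block a A zero    zero    = a
block a A zero    (suc j) = 0ℤ
block a A (suc i) zero    = 0ℤ
block a A (suc i) (suc j) = A i j

block-cong : ∀ {n} {a b} {A B : Mat n n} → a ≡ b → A ≈ B → block a A ≈ block b B
block-cong e f zero    zero    = e
block-cong e f zero    (suc j) = refl
block-cong e f (suc i) zero    = refl
block-cong e f (suc i) (suc j) = f i j

block-⊗ : ∀ {n} a b (A B : Mat n n) → block a A ⊗ block b B ≈ block (a * b) (A ⊗ B)
block-⊗ {n} a b A B zero zero =
  trans (cong (a * b +_) (sum-zero n)) (ℤ.+-identityʳ _)
block-⊗ {n} a b A B zero (suc j) =
  cong₂ _+_ (ℤ.*-zeroʳ a) (trans (sum-cong (λ k → ℤ.*-zeroˡ (B k j))) (sum-zero n))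
block-⊗ {n} a b A B (suc i) zero =
  cong₂ _+_ (ℤ.*-zeroˡ b) (trans (sum-cong (λ k → ℤ.*-zeroʳ (A i k))) (sum-zero n))
block-⊗ a b A B (suc i) (suc j) = ℤ.+-identityˡ _

block-unit : ∀ {n} → block {n} 1ℤ unit ≈ unit
block-unit zero    zero    = refl
block-unit zero    (suc j) = refl
block-unit (suc i) zero    = refl
block-unit (suc i) (suc j) = sym (unit-suc i j)

block-unimodular : ∀ {n} → Unimodular n → Unimodular (suc n)
block-unimodular P = record
  { mat = block 1ℤ (mat P)
  ; inv = block 1ℤ (inv P)
  ; mat-inv = ≈-trans (block-⊗ 1ℤ 1ℤ (mat P) (inv P)) (≈-trans (block-cong refl (mat-inv P)) block-unit)
  ; inv-mat = ≈-trans (block-⊗ 1ℤ 1ℤ (inv P) (mat P)) (≈-trans (block-cong refl (inv-mat P)) block-unit)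
  }

diagonalise-block : ∀ {n} (N : Mat (suc n) (suc n)) →
  (∀ j → N zero (suc j) ≡ 0ℤ) → (∀ i → N (suc i) zero ≡ 0ℤ) →
  Diagonalisation (λ i j → N (suc i) (suc j)) → Diagonalisation N
diagonalise-block {n} N row col D = record
  { P = block-unimodular (P D)
  ; Q = block-unimodular (Q D)
  ; d = d′
  ; PNQ =
      ≈-trans (⊗-congˡ bQ (≈-trans (⊗-congʳ bP N≈block) (block-⊗ 1ℤ a (mat (P D)) N′)))
      (≈-trans (block-⊗ (1ℤ * a) 1ℤ (mat (P D) ⊗ N′) (mat (Q D)))
      (≈-trans (block-cong (trans (ℤ.*-identityʳ (1ℤ * a)) (ℤ.*-identityˡ a)) (PNQ D)) block-diag))
  }
  where
  a  = N zero zero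
  N′ = λ i j → N (suc i) (suc j)
  bP = block 1ℤ (mat (P D))
  bQ = block 1ℤ (mat (Q D))
  d′ : Vec (suc n)
  d′ zero    = a
  d′ (suc i) = d D i
  N≈block : N ≈ block a N′
  N≈block zero    zero    = refl
  N≈block zero    (suc j) = row j
  N≈block (suc i) zero    = col i
  N≈block (suc i) (suc j) = refl
  block-diag : block a (diag (d D)) ≈ diag d′
  block-diag zero    zero    = sym (ℤ.*-identityʳ a)
  block-diag zero    (suc j) = sym (ℤ.*-zeroʳ a)
  block-diag (suc i) zero    = sym (ℤ.*-zeroʳ (d D i))
  block-diag (suc i) (suc j) = cong (d D i *_) (sym (unit-suc i j))

-- Reduction to diagonal form by row operations

shear : ∀ {n} → Vec n → Mat (suc n) (suc n)
shear q zero            = unit zero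
shear q (suc i) zero    = q i
shear q (suc i) (suc j) = unit i j

shear-zero : ∀ {n p} (q : Vec n) (N : Mat (suc n) p) → (shear q ⊗ N) zero ≗ N zero
shear-zero q N j = sum-unit zero (λ k → N k j)

shear-suc : ∀ {n p} (q : Vec n) (N : Mat (suc n) p) i j →
  (shear q ⊗ N) (suc i) j ≡ q i * N zero j + N (suc i) j
shear-suc q N i j = cong (q i * N zero j +_) (sum-unit i (λ k → N (suc k) j))

shear-inverse : ∀ {n} (q r : Vec n) → (∀ i → q i + r i ≡ 0ℤ) → shear q ⊗ shear r ≈ unit
shear-inverse q r e zero    j       = shear-zero q (shear r) j
shear-inverse q r e (suc i) zero    =
  trans (shear-suc q (shear r) i zero) (trans (cong (_+ r i) (ℤ.*-identityʳ (q i))) (e i))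
shear-inverse q r e (suc i) (suc j) =
  trans (shear-suc q (shear r) i (suc j))
  (trans (cong (_+ unit i j) (ℤ.*-zeroʳ (q i))) (trans (ℤ.+-identityˡ _) (sym (unit-suc i j))))

shear-unimodular : ∀ {n} → Vec n → Unimodular (suc n)
shear-unimodular q = record
  { mat = shear q
  ; inv = shear (λ i → - q i)
  ; mat-inv = shear-inverse q _ (λ i → ℤ.+-inverseʳ (q i))
  ; inv-mat = shear-inverse _ q (λ i → ℤ.+-inverseˡ (q i))
  }

swap-unimodular : ∀ {n} → Fin n → Fin n → Unimodular n
swap-unimodular a b = record
  { mat = λ k → unit (transpose a b k)
  ; inv = λ k → unit (transpose b a k)
  ; mat-inv = λ k j → trans (sum-unit (transpose a b k) (λ l → unit (transpose b a l) j))
                            (cong (λ l → unit l j) (transpose-inverse b a))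
  ; inv-mat = λ k j → trans (sum-unit (transpose b a k) (λ l → unit (transpose a b l) j))
                            (cong (λ l → unit l j) (transpose-inverse a b))
  }

swap-pivot : ∀ {n} (i : Fin (suc n)) (N : Mat (suc n) (suc n)) →
  (mat (swap-unimodular zero i) ⊗ N) zero zero ≡ N i zero
swap-pivot i N = sum-unit i (λ k → N k zero)

-- One step of Euclid's algorithm. Division by the pivot leaves the remainder `b % a` at the top of
-- row `i + 1`; it is nonzero because the pivot does not divide `b`, and swapping it to the top
-- gives a strictly smaller pivot.
pivot-step : ∀ {n} (N : Mat (suc n) (suc n)) → N zero zero ≢ 0ℤ →
  (∀ M → M zero zero ≢ 0ℤ → ∣ M zero zero ∣ ℕ.< ∣ N zero zero ∣ → Diagonalisation M) →
  ∀ i → ¬ (N zero zero ∣ N (suc i) zero) → Diagonalisation N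
pivot-step N a≢0 ih i a∤b =
  diagonalise-row E₁ (diagonalise-row E₂ (ih M pivot≢0 pivot<))
  where
  a = N zero zero
  b = N (suc i) zero
  instance
    a-nonZero : NonZero a
    a-nonZero = ≢-nonZero a≢0
  q = λ k → - (N (suc k) zero / a)
  E₁ = shear-unimodular q
  E₂ = swap-unimodular zero (suc i)
  M  = mat E₂ ⊗ (mat E₁ ⊗ N)
  cancel : ∀ q a r → - q * a + (r + q * a) ≡ r
  cancel = solve-∀
  pivot : M zero zero ≡ ℤ.+ (b % a)
  pivot = begin
    M zero zero                             ≡⟨ swap-pivot (suc i) (mat E₁ ⊗ N) ⟩
    (mat E₁ ⊗ N) (suc i) zero               ≡⟨ shear-suc q N i zero ⟩
    - (b / a) * a + b                       ≡⟨ cong (- (b / a) * a +_) (a≡a%n+[a/n]*n b a) ⟩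
    - (b / a) * a + (ℤ.+ (b % a) + b / a * a) ≡⟨ cancel (b / a) a (ℤ.+ (b % a)) ⟩
    ℤ.+ (b % a)                             ∎
  pivot≢0 : M zero zero ≢ 0ℤ
  pivot≢0 e = a∤b (divides (b / a) (trans (a≡a%n+[a/n]*n b a)
    (trans (cong (_+ b / a * a) (trans (sym pivot) e)) (ℤ.+-identityˡ _))))
  pivot< : ∣ M zero zero ∣ ℕ.< ∣ a ∣
  pivot< = subst (λ z → ∣ z ∣ ℕ.< ∣ a ∣) (sym pivot) (n%d<d b a)

-- The continuation also learns that the top row is unchanged, so that clearing the column and then,
-- on the transpose, the row does not undo the first clearing.
clear-column : ∀ {n} (N : Mat (suc n) (suc n)) → (∀ i → N zero zero ∣ N (suc i) zero) →
  (∀ M → M zero ≗ N zero → (∀ i → M (suc i) zero ≡ 0ℤ) → Diagonalisation M) →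
  Diagonalisation N
clear-column N a∣ k = diagonalise-row E (k (mat E ⊗ N) (shear-zero r N) cleared)
  where
  r = λ i → - _∣_.quotient (a∣ i)
  E = shear-unimodular r
  cancel : ∀ q a → - q * a + q * a ≡ 0ℤ
  cancel = solve-∀
  cleared : ∀ i → (mat E ⊗ N) (suc i) zero ≡ 0ℤ
  cleared i = trans (shear-suc r N i zero)
    (trans (cong (- q * N zero zero +_) (_∣_.equality (a∣ i))) (cancel q (N zero zero)))
    where q = _∣_.quotient (a∣ i)

diagonalise-pivot : ∀ {n} → (∀ M → Diagonalisation {n} M) →
  (N : Mat (suc n) (suc n)) → N zero zero ≢ 0ℤ → Acc ℕ._<_ ∣ N zero zero ∣ → Diagonalisation N
diagonalise-pivot smaller N a≢0 (acc rs)
  with any? (λ i → ¬? (N zero zero ∣? N (suc i) zero))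
     | any? (λ j → ¬? (N zero zero ∣? N zero (suc j)))
... | yes (i , a∤) | _ =
      pivot-step N a≢0 (λ M M≢0 M< → diagonalise-pivot smaller M M≢0 (rs M<)) i a∤
... | no _ | yes (j , a∤) = diagonalise-ᵀ
      (pivot-step (N ᵀ) a≢0 (λ M M≢0 M< → diagonalise-pivot smaller M M≢0 (rs M<)) j a∤)
... | no col | no row =
      clear-column N (λ i → decidable-stable (_ ∣? _) (λ a∤ → col (i , a∤)))
      -- The first clearing kept the top row, so the pivot still divides it. The second keeps the
      -- top row of `M ᵀ`, which is the column of `M` that is already cleared.
      λ M M₀ M-col → diagonalise-ᵀ (clear-column (M ᵀ)
        (λ j → subst₂ _∣_ (sym (M₀ zero)) (sym (M₀ (suc j)))
                 (decidable-stable (_ ∣? _) (λ a∤ → row (j , a∤))))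
        λ M′ M′₀ M′-col → diagonalise-block M′ (λ j → trans (M′₀ (suc j)) (M-col j)) M′-col (smaller _))

diagonalise-column : ∀ {n} → (∀ M → Diagonalisation {n} M) →
  (N : Mat (suc n) (suc n)) → ∀ i → N i zero ≢ 0ℤ → Diagonalisation N
diagonalise-column smaller N i b≢0 = diagonalise-row (swap-unimodular zero i)
  (diagonalise-pivot smaller _ (b≢0 ∘ trans (sym (swap-pivot i N))) (<-wellFounded _))

diagonalise : ∀ {n} (N : Mat n n) → Diagonalisation N
diagonalise {zero}  N = record
  { P = unit-unimodular 0 ; Q = unit-unimodular 0 ; d = λ () ; PNQ = λ () }
diagonalise {suc n} N
  with any? (λ i → ¬? (N i zero ℤ.≟ 0ℤ)) | any? (λ j → ¬? (N zero j ℤ.≟ 0ℤ))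
... | yes (i , b≢0) | _ = diagonalise-column diagonalise N i b≢0
... | no _ | yes (j , b≢0) = diagonalise-ᵀ (diagonalise-column diagonalise (N ᵀ) j b≢0)
... | no col | no row = diagonalise-block N
      (λ j → decidable-stable (_ ℤ.≟ _) (λ b≢0 → row (suc j , b≢0)))
      (λ i → decidable-stable (_ ℤ.≟ _) (λ b≢0 → col (suc i , b≢0)))
      (diagonalise _)

-- Row spans

0v : ∀ {n} → Vec n
0v _ = 0ℤ

⊖-scale : ∀ {n} (x y : Vec n) → x ⊖ y ≗ x ⊕ scale -1ℤ y
⊖-scale x y i = solution (x i) (y i)
  where
  solution : ∀ a b → a - b ≡ a + -1ℤ * b
  solution = solve-∀

·-⊖ : ∀ {m n} (x y : Vec m) (A : Mat m n) → (x ⊖ y) · A ≗ (x · A) ⊖ (y · A)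
·-⊖ x y A j = begin
  ((x ⊖ y) · A) j               ≡⟨ ·-congˡ A (⊖-scale x y) j ⟩
  ((x ⊕ scale -1ℤ y) · A) j     ≡⟨ ·-⊕ x (scale -1ℤ y) A j ⟩
  (x · A) j + (scale -1ℤ y · A) j  ≡⟨ cong ((x · A) j +_) (·-scale -1ℤ y A j) ⟩
  (x · A) j + -1ℤ * (y · A) j   ≡⟨ ⊖-scale (x · A) (y · A) j ⟨
  (x · A) j - (y · A) j         ∎

span-resp : ∀ {m n} {R : Mat m n} {x y : Vec n} → x ≗ y → InSpan R x → InSpan R y
span-resp x≗y (c , e) = c , λ j → trans (sym (x≗y j)) (e j)

span-zero : ∀ {m n} {R : Mat m n} → InSpan R 0v
span-zero {m} {R = R} = 0v , λ j →
  sym (trans (sum-cong {m} (λ i → ℤ.*-zeroˡ (R i j))) (sum-zero m))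

span-⊕ : ∀ {m n} {R : Mat m n} {x y : Vec n} → InSpan R x → InSpan R y → InSpan R (x ⊕ y)
span-⊕ {R = R} (c , e) (c′ , e′) = (c ⊕ c′) , λ j →
  trans (cong₂ _+_ (e j) (e′ j)) (sym (·-⊕ c c′ R j))

span-scale : ∀ {m n} {R : Mat m n} a {x : Vec n} → InSpan R x → InSpan R (scale a x)
span-scale {R = R} a (c , e) = scale a c , λ j →
  trans (cong (a *_) (e j)) (sym (·-scale a c R j))

span-⊖ : ∀ {m n} {R : Mat m n} {x y : Vec n} → InSpan R x → InSpan R y → InSpan R (x ⊖ y)
span-⊖ {x = x} {y} p q =
  span-resp (λ i → sym (⊖-scale x y i)) (span-⊕ p (span-scale -1ℤ q))

span-row : ∀ {m n} (R : Mat m n) i → InSpan R (R i)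
span-row R i = unit i , λ j → sym (sum-unit i (λ k → R k j))

span-· : ∀ {m n m′ n′} {R : Mat m n} {S : Mat m′ n′} (A : Mat n n′) →
  (∀ i → InSpan S (R i · A)) → ∀ {x} → InSpan R x → InSpan S (x · A)
span-· {R = R} {S} A h {x} (c , e) = c · (proj₁ ∘ h) , λ j → begin
  (x · A) j                ≡⟨ ·-congˡ A e j ⟩
  (c · R · A) j            ≡⟨ ·-assoc c R A j ⟩
  (c · (R ⊗ A)) j          ≡⟨ ·-congʳ c (proj₂ ∘ h) j ⟩
  (c · ((proj₁ ∘ h) ⊗ S)) j  ≡⟨ ·-assoc c (proj₁ ∘ h) S j ⟨
  (c · (proj₁ ∘ h) · S) j  ∎

span-⊆ : ∀ {m m′ n} {R : Mat m n} {S : Mat m′ n} →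
  (∀ i → InSpan S (R i)) → ∀ {x} → InSpan R x → InSpan S x
span-⊆ {R = R} {S} h {x} p = span-resp (·-identityʳ x)
  (span-· unit (λ i → span-resp (λ j → sym (·-identityʳ (R i) j)) (h i)) p)

·-diag : ∀ {n} (x d : Vec n) → x · diag d ≗ λ i → x i * d i
·-diag x d j = begin
  sumFin (λ i → x i * (d i * unit i j))  ≡⟨ sum-cong (λ i → sym (ℤ.*-assoc (x i) (d i) (unit i j))) ⟩
  ((λ i → x i * d i) · unit) j           ≡⟨ ·-identityʳ (λ i → x i * d i) j ⟩
  x j * d j                              ∎

mat-inv-· : ∀ {n} (U : Unimodular n) (x : Vec n) → x · mat U · inv U ≗ x
mat-inv-· U x j =
  trans (·-assoc x (mat U) (inv U) j) (trans (·-congʳ x (mat-inv U) j) (·-identityʳ x j))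

inv-mat-· : ∀ {n} (U : Unimodular n) (x : Vec n) → x · inv U · mat U ≗ x
inv-mat-· U x j =
  trans (·-assoc x (inv U) (mat U) j) (trans (·-congʳ x (inv-mat U) j) (·-identityʳ x j))

PNQ-· : ∀ {n} {N : Mat n n} (D : Diagonalisation N) (y : Vec n) →
  y · mat (P D) · N · mat (Q D) ≗ λ i → y i * d D i
PNQ-· {N = N} D y i = begin
  (y · p · N · q) i      ≡⟨ ·-congˡ q (·-assoc y p N) i ⟩
  (y · (p ⊗ N) · q) i    ≡⟨ ·-assoc y (p ⊗ N) q i ⟩
  (y · (p ⊗ N ⊗ q)) i    ≡⟨ ·-congʳ y (PNQ D) i ⟩
  (y · diag (d D)) i     ≡⟨ ·-diag y (d D) i ⟩
  y i * d D i            ∎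
  where
  p = mat (P D)
  q = mat (Q D)

-- The columns of `Q` are coordinates in which the row span becomes the product of the ideals
-- generated by the `d i`: if `x` is `c · N`, then `x · Q` is `c · P⁻¹` times the diagonal matrix.
-- With the converse below, membership in a span is tested by divisibility, one coordinate at a
-- time.
span⇒∣ : ∀ {n} {N : Mat n n} (D : Diagonalisation N) {x} →
  InSpan N x → ∀ i → d D i ∣ (x · mat (Q D)) i
span⇒∣ {N = N} D {x} (c , e) i = divides (y i) (begin
  (x · q) i              ≡⟨ ·-congˡ q e i ⟩
  (c · N · q) i          ≡⟨ ·-congˡ q (·-congˡ N (λ j → sym (inv-mat-· (P D) c j))) i ⟩
  (y · mat (P D) · N · q) i  ≡⟨ PNQ-· D y i ⟩
  y i * d D i            ∎)
  where
  q = mat (Q D)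
  y = c · inv (P D)

∣⇒span : ∀ {n} {N : Mat n n} (D : Diagonalisation N) {x} →
  (∀ i → d D i ∣ (x · mat (Q D)) i) → InSpan N x
∣⇒span {N = N} D {x} h = y · mat (P D) , λ j → begin
  x j                                    ≡⟨ mat-inv-· (Q D) x j ⟨
  (x · q · q′) j                         ≡⟨ ·-congˡ q′ (λ i → trans (_∣_.equality (h i)) (sym (PNQ-· D y i))) j ⟩
  (y · mat (P D) · N · q · q′) j         ≡⟨ mat-inv-· (Q D) (y · mat (P D) · N) j ⟩
  (y · mat (P D) · N) j                  ∎
  where
  q = mat (Q D)
  q′ = inv (Q D)
  y = λ i → _∣_.quotient (h i)

-- Pigeonhole principles

injective⇒surjective : ∀ {n} (f : Fin n → Fin n) → Injective _≡_ _≡_ f → ∀ y → ∃ λ x → f x ≡ y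
injective⇒surjective {suc n} f inj y with any? (λ x → f x ≟ y)
... | yes p = p
... | no ∄x = contradiction
      (injective⇒≤ {f = λ x → punchOut (y≢ x)} (λ {x} {x′} → inj ∘ punchOut-injective (y≢ x) (y≢ x′)))
      ℕ.1+n≰n
  where
  y≢ : ∀ x → y ≢ f x
  y≢ x e = ∄x (x , sym e)

-- Choose for each class a preimage of its representative. Sending a class to the class of that
-- preimage is an injective self-map of `Fin p`, since `f` recovers the original class; hence it is
-- onto. So every element is equivalent to a chosen preimage, and `f` separates those.
surjective⇒injective : ∀ {A : Set} {_∼_ : A → A → Set} → IsEquivalence _∼_ →
  ∀ {p} (class : A → Fin p) →
  (∀ {a b} → a ∼ b → class a ≡ class b) → (∀ {a b} → class a ≡ class b → a ∼ b) →
  (∀ c → ∃ λ a → class a ≡ c) →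
  (f : A → A) → (∀ {a b} → a ∼ b → f a ∼ f b) → (∀ y → ∃ λ x → f x ∼ y) →
  ∀ {a b} → f a ∼ f b → a ∼ b
surjective⇒injective {A} {_∼_} isEq {p} class class-cong class-inj rep f f-cong pre {a} {b} fa∼fb =
  let c  , hc  = injective⇒surjective h h-inj (class a)
      c′ , hc′ = injective⇒surjective h h-inj (class b)
      c≡c′ = rep-inj (E.trans (E.sym (f-section c hc)) (E.trans fa∼fb (f-section c′ hc′)))
  in  class-inj (trans (sym hc) (trans (cong h c≡c′) hc′))
  where
  module E = IsEquivalence isEq
  section : Fin p → A
  section c = proj₁ (pre (proj₁ (rep c)))
  h : Fin p → Fin p
  h = class ∘ section
  f-section : ∀ c {x} → class (section c) ≡ class x → f x ∼ proj₁ (rep c)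
  f-section c e = E.trans (f-cong (class-inj (sym e))) (proj₂ (pre (proj₁ (rep c))))
  rep-inj : ∀ {c c′} → proj₁ (rep c) ∼ proj₁ (rep c′) → c ≡ c′
  rep-inj {c} {c′} e = trans (sym (proj₂ (rep c))) (trans (class-cong e) (proj₂ (rep c′)))
  h-inj : Injective _≡_ _≡_ h
  h-inj {c} {c′} e = rep-inj
    (E.trans (E.sym (f-section c refl)) (f-section c′ (sym e)))

-- The Hopfian property

residue : ∀ m → ℤ → Fin (suc m)
residue m z = fromℕ< (n%ℕd<d z (suc m))

toℕ-residue : ∀ m z → toℕ (residue m z) ≡ z %ℕ suc m
toℕ-residue m z = toℕ-fromℕ< (n%ℕd<d z (suc m))

residue-decomp : ∀ m z → ∃ λ q → z ≡ ℤ.+ toℕ (residue m z) + q * ℤ.+ suc m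
residue-decomp m z = z /ℕ suc m ,
  trans (a≡a%ℕn+[a/ℕn]*n z (suc m)) (cong (λ r → ℤ.+ r + z /ℕ suc m * ℤ.+ suc m) (sym (toℕ-residue m z)))

∣-small : ∀ {m} (r s : Fin m) → ℤ.+ m ∣ ℤ.+ toℕ r - ℤ.+ toℕ s → r ≡ s
∣-small {m} r s m∣ = toℕ-injective (ℤ.+-injective (ℤ.i-j≡0⇒i≡j _ _ (ℤ.∣i∣≡0⇒i≡0 zero-abs)))
  where
  small : ∣ ℤ.+ toℕ r - ℤ.+ toℕ s ∣ ℕ.< m
  small = subst (λ z → ∣ z ∣ ℕ.< m) (sym (ℤ.m-n≡m⊖n (toℕ r) (toℕ s)))
    (ℕ.≤-<-trans (ℤ.∣m⊝n∣≤m⊔n (toℕ r) (toℕ s)) (ℕ.⊔-lub (toℕ<n r) (toℕ<n s)))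
  zero-abs : ∣ ℤ.+ toℕ r - ℤ.+ toℕ s ∣ ≡ 0
  zero-abs with ∣ ℤ.+ toℕ r - ℤ.+ toℕ s ∣ in eq
  ... | zero  = refl
  ... | suc k = contradiction (subst (m ℕ.∣_) eq (∣⇒∣ᵤ m∣))
                  (ℕ.>⇒∤ (subst (ℕ._< m) eq small))

residue-cong : ∀ m {a b} → ℤ.+ suc m ∣ a - b → residue m a ≡ residue m b
residue-cong m {a} {b} m∣ with residue-decomp m a | residue-decomp m b
... | qa , ea | qb , eb = ∣-small (residue m a) (residue m b)
    (subst (ℤ.+ suc m ∣_) (sym rewritten)
      (∣m∣n⇒∣m+n m∣ (∣n⇒∣m*n (qb - qa) ∣-refl)))
  where
  ra = ℤ.+ toℕ (residue m a)
  rb = ℤ.+ toℕ (residue m b)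
  shift : ∀ r s p q n → r - s ≡ (r + p * n - (s + q * n)) + (q - p) * n
  shift = solve-∀
  rewritten : ra - rb ≡ a - b + (qb - qa) * ℤ.+ suc m
  rewritten = trans (shift ra rb qa qb (ℤ.+ suc m))
    (cong (_+ (qb - qa) * ℤ.+ suc m) (sym (cong₂ _-_ ea eb)))

residue-injective : ∀ m {a b} → residue m a ≡ residue m b → ℤ.+ suc m ∣ a - b
residue-injective m {a} {b} e with residue-decomp m a | residue-decomp m b
... | qa , ea | qb , eb = divides (qa - qb) (begin
  a - b                                    ≡⟨ cong₂ _-_ ea eb ⟩
  ra + qa * M - (rb + qb * M)              ≡⟨ cong (λ r → ra + qa * M - (ℤ.+ toℕ r + qb * M)) (sym e) ⟩
  ra + qa * M - (ra + qb * M)              ≡⟨ shift ra qa qb M ⟩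
  (qa - qb) * M                            ∎)
  where
  M = ℤ.+ suc m
  ra = ℤ.+ toℕ (residue m a)
  rb = ℤ.+ toℕ (residue m b)
  shift : ∀ r p q n → r + p * n - (r + q * n) ≡ (p - q) * n
  shift = solve-∀

residue-toℕ : ∀ m (r : Fin (suc m)) → residue m (ℤ.+ toℕ r) ≡ r
residue-toℕ m r with q , e ← residue-decomp m (ℤ.+ toℕ r) =
  sym (∣-small r (residue m (ℤ.+ toℕ r)) (divides q (trans (cong (_- s) e) (cancel s (q * ℤ.+ suc m)))))
  where
  s = ℤ.+ toℕ (residue m (ℤ.+ toℕ r))
  cancel : ∀ a b → a + b - a ≡ b
  cancel = solve-∀

-- Here and below `m i` encodes the modulus `m i + 1`, which is therefore positive. Tuples of
-- residues are packed into a single `Fin` so that the pigeonhole principle applies to them.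
residueCount : ∀ {n} → (Fin n → ℕ) → ℕ
residueCount {zero}  m = 1
residueCount {suc n} m = suc (m zero) ℕ.* residueCount (m ∘ suc)

residues : ∀ {n} (m : Fin n → ℕ) → Vec n → Fin (residueCount m)
residues {zero}  m y = zero
residues {suc n} m y = combine (residue (m zero) (y zero)) (residues (m ∘ suc) (y ∘ suc))

residues-cong : ∀ {n} (m : Fin n → ℕ) {x y : Vec n} →
  (∀ i → ℤ.+ suc (m i) ∣ x i - y i) → residues m x ≡ residues m y
residues-cong {zero}  m h = refl
residues-cong {suc n} m {x} {y} h = cong₂ combine
  (residue-cong (m zero) {x zero} {y zero} (h zero))
  (residues-cong (m ∘ suc) {x ∘ suc} {y ∘ suc} (h ∘ suc))

residues-injective : ∀ {n} (m : Fin n → ℕ) {x y : Vec n} →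
  residues m x ≡ residues m y → ∀ i → ℤ.+ suc (m i) ∣ x i - y i
residues-injective {suc n} m {x} {y} e i with i | combine-injective
  (residue (m zero) (x zero)) (residues (m ∘ suc) (x ∘ suc))
  (residue (m zero) (y zero)) (residues (m ∘ suc) (y ∘ suc)) e
... | zero  | e₀ , _ = residue-injective (m zero) {x zero} {y zero} e₀
... | suc j | _ , e₊ = residues-injective (m ∘ suc) {x ∘ suc} {y ∘ suc} e₊ j

residues-surjective : ∀ {n} (m : Fin n → ℕ) c → ∃ λ x → residues m x ≡ c
residues-surjective {zero}  m zero = 0v , refl
residues-surjective {suc n} m c
  with x , e ← residues-surjective (m ∘ suc) (proj₂ (remQuot {suc (m zero)} (residueCount (m ∘ suc)) c)) =
  x′ , trans (cong₂ combine (residue-toℕ (m zero) r) e) (combine-remQuot {suc (m zero)} (residueCount (m ∘ suc)) c)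
  where
  r = proj₁ (remQuot {suc (m zero)} (residueCount (m ∘ suc)) c)
  x′ : Vec _
  x′ zero    = ℤ.+ toℕ r
  x′ (suc i) = x i

common-multiple : ∀ {n} (m : Fin n → ℕ) → ∃ λ k → ∀ i → suc (m i) ℕ.∣ suc k
common-multiple {zero}  m = 0 , λ ()
common-multiple {suc n} m with k , h ← common-multiple (m ∘ suc) =
  -- The successor of this number is `suc (m zero) * suc k`, the product of all the moduli.
  k ℕ.+ m zero ℕ.* suc k , λ where
    zero    → ℕ.m∣m*n (suc k)
    (suc i) → ℕ.∣n⇒∣m*n (suc (m zero)) (h i)

-- modulus d k + 1 generates the ideal (d , k + 1) when d is 0 or divides k + 1.
modulus : ℤ → ℕ → ℕ
modulus (ℤ.+ zero)    k = k
modulus (ℤ.+ (suc m)) k = m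
modulus ℤ.-[1+ m ]    k = m

∣⇒modulus∣ : ∀ d k {y} → d ∣ y → ℤ.+ suc (modulus d k) ∣ y
∣⇒modulus∣ (ℤ.+ zero)  k d∣y = subst (ℤ.+ suc k ∣_) (sym (0∣⇒≡0 d∣y)) (divides 0ℤ refl)
∣⇒modulus∣ (ℤ.+ suc m) k d∣y = d∣y
∣⇒modulus∣ ℤ.-[1+ m ]  k d∣y = ∣-trans ∣m∣∣m d∣y

-- The second argument of `modulus` matters only for `d = 0`, and there both sides of the conclusion
-- are `k + 1`. Allowing `l` to differ from `k` breaks a circle: `k` is built from the moduli taken
-- at other values `l`.
modulus∣multiple : ∀ d k l → suc (modulus d l) ℕ.∣ suc k → ℤ.+ suc (modulus d k) ∣ ℤ.+ suc k
modulus∣multiple (ℤ.+ zero)  k l h = ∣-refl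
modulus∣multiple (ℤ.+ suc m) k l h = ∣ᵤ⇒∣ h
modulus∣multiple ℤ.-[1+ m ]  k l h = ∣ᵤ⇒∣ h

modulus-split : ∀ d k {y} → ℤ.+ suc (modulus d k) ∣ y →
  ∃ λ u → ∃ λ v → y ≡ u * d + ℤ.+ suc k * v
modulus-split (ℤ.+ zero)  k (divides q e) = 0ℤ , q , trans e (solution q (ℤ.+ suc k))
  where
  solution : ∀ q k → q * k ≡ 0ℤ * 0ℤ + k * q
  solution = solve-∀
modulus-split d@(ℤ.+ suc m) k (divides q e) = q , 0ℤ , trans e (solution q d (ℤ.+ suc k))
  where
  solution : ∀ q d k → q * d ≡ q * d + k * 0ℤ
  solution = solve-∀
modulus-split d@(ℤ.-[1+ m ]) k {y} d∣y with divides q e ← ∣-trans {d} m∣∣m∣ d∣y =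
  q , 0ℤ , trans e (solution q d (ℤ.+ suc k))
  where
  solution : ∀ q d k → q * d ≡ q * d + k * 0ℤ
  solution = solve-∀

-- The case `d = 0` is where a finite quotient detects a nonzero integer: if `y` were nonzero,
-- `∣ y ∣ + 1` would divide `k + 1`, which divides `y`, although it exceeds `∣ y ∣`. For other `d`
-- the modulus is `∣ d ∣`.
modulus∣⇒∣ : ∀ d k y → suc (modulus d ∣ y ∣) ℕ.∣ suc k → ℤ.+ suc (modulus d k) ∣ y → d ∣ y
modulus∣⇒∣ (ℤ.+ zero) k y h k∣y with ∣ y ∣ in eq
... | zero  = subst (0ℤ ∣_) (sym (ℤ.∣i∣≡0⇒i≡0 eq)) ∣-refl
... | suc a = contradiction (ℕ.∣-trans h (subst (suc k ℕ.∣_) eq (∣⇒∣ᵤ k∣y))) (ℕ.>⇒∤ (ℕ.n<1+n (suc a)))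
modulus∣⇒∣ (ℤ.+ suc m) k y h m∣y = m∣y
modulus∣⇒∣ d@(ℤ.-[1+ m ]) k y h m∣y = ∣-trans {d} m∣∣m∣ m∣y

-- Residual finiteness: modulo L + (k + 1) ℤⁿ, which F preserves, there are
-- finitely many classes, and k is chosen so that a given x in L + (k + 1) ℤⁿ lies in L.
hopfian : ∀ {n} (N F : Mat n n) → (∀ i → InSpan N (N i · F)) →
  (∀ y → ∃ λ x → InSpan N ((x · F) ⊖ y)) →
  ∀ {x} → InSpan N (x · F) → InSpan N x
hopfian {n} N F invariant onto {x} xF∈ =
  ∣⇒span D (λ i → modulus∣⇒∣ (δ i) k ((x · q) i) (k-multiple i) (x∈Lk i))
  where
  D = diagonalise N
  q = mat (Q D)
  q′ = inv (Q D)
  δ = d D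
  m : Fin n → ℕ
  -- Where `δ i` is zero this makes the modulus `m i + 1` exceed the absolute value of the
  -- coordinate of `x`.
  m i = modulus (δ i) ∣ (x · q) i ∣
  k = proj₁ (common-multiple m)
  k-multiple = proj₂ (common-multiple m)
  e : Fin n → ℕ
  e i = modulus (δ i) k
  Lk : Vec n → Set
  Lk y = ∀ i → ℤ.+ suc (e i) ∣ (y · q) i
  Lk-resp : ∀ {y z} → y ≗ z → Lk y → Lk z
  Lk-resp y≗z h i = subst (ℤ.+ suc (e i) ∣_) (·-congˡ q y≗z i) (h i)
  Lk-⊕ : ∀ {y z} → Lk y → Lk z → Lk (y ⊕ z)
  Lk-⊕ {y} {z} h h′ i = subst (ℤ.+ suc (e i) ∣_) (sym (·-⊕ y z q i)) (∣m∣n⇒∣m+n (h i) (h′ i))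
  Lk-scale : ∀ a {y} → Lk y → Lk (scale a y)
  Lk-scale a {y} h i = subst (ℤ.+ suc (e i) ∣_) (sym (·-scale a y q i)) (∣n⇒∣m*n a (h i))
  span⇒Lk : ∀ {y} → InSpan N y → Lk y
  span⇒Lk p i = ∣⇒modulus∣ (δ i) k (span⇒∣ D p i)
  Lk-multiple : ∀ y → Lk (scale (ℤ.+ suc k) y)
  Lk-multiple y i = subst (ℤ.+ suc (e i) ∣_) (sym (·-scale (ℤ.+ suc k) y q i))
    (∣m⇒∣m*n ((y · q) i) (modulus∣multiple (δ i) k ∣ (x · q) i ∣ (k-multiple i)))
  -- A member of `Lk` is a member of the span plus `k + 1` times a vector. `F` preserves the span by
  -- `invariant` and multiples of `k + 1` by linearity.
  Lk-F : ∀ {y} → Lk y → Lk (y · F)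
  Lk-F {y} h = Lk-resp split-F
    (Lk-⊕ {w · F} (span⇒Lk (span-· {R = N} {N} F invariant {w} w∈)) (Lk-multiple (v · q′ · F)))
    where
    u = λ i → proj₁ (modulus-split (δ i) k (h i))
    v = λ i → proj₁ (proj₂ (modulus-split (δ i) k (h i)))
    ud = λ i → u i * δ i
    w = ud · q′
    w∈ : InSpan N w
    w∈ = ∣⇒span D (λ i → divides (u i) (inv-mat-· (Q D) ud i))
    split : w ⊕ scale (ℤ.+ suc k) (v · q′) ≗ y
    split j = begin
      (ud · q′) j + ℤ.+ suc k * (v · q′) j        ≡⟨ cong ((ud · q′) j +_) (·-scale (ℤ.+ suc k) v q′ j) ⟨
      (ud · q′) j + (scale (ℤ.+ suc k) v · q′) j  ≡⟨ ·-⊕ ud (scale (ℤ.+ suc k) v) q′ j ⟨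
      ((ud ⊕ scale (ℤ.+ suc k) v) · q′) j         ≡⟨ ·-congˡ q′ (λ i → sym (proj₂ (proj₂ (modulus-split (δ i) k (h i))))) j ⟩
      (y · q · q′) j                              ≡⟨ mat-inv-· (Q D) y j ⟩
      y j                                         ∎
    split-F : (w · F) ⊕ scale (ℤ.+ suc k) (v · q′ · F) ≗ y · F
    split-F j = begin
      (w · F) j + ℤ.+ suc k * (v · q′ · F) j        ≡⟨ cong ((w · F) j +_) (·-scale (ℤ.+ suc k) (v · q′) F j) ⟨
      (w · F) j + (scale (ℤ.+ suc k) (v · q′) · F) j  ≡⟨ ·-⊕ w (scale (ℤ.+ suc k) (v · q′)) F j ⟨
      ((w ⊕ scale (ℤ.+ suc k) (v · q′)) · F) j      ≡⟨ ·-congˡ F split j ⟩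
      (y · F) j                                     ∎
  _∼_ : Vec n → Vec n → Set
  y ∼ z = Lk (y ⊖ z)
  isEq : IsEquivalence _∼_
  isEq = record
    { refl = λ {y} → Lk-resp (λ i → sym (ℤ.+-inverseʳ (y i))) (span⇒Lk (span-zero {R = N}))
    ; sym = λ {y} {z} h → Lk-resp (λ i → neg (y i) (z i)) (Lk-scale -1ℤ {y ⊖ z} h)
    ; trans = λ {x} {y} {z} h h′ → Lk-resp (λ i → telescope (x i) (y i) (z i)) (Lk-⊕ {x ⊖ y} {y ⊖ z} h h′)
    }
    where
    neg : ∀ a b → -1ℤ * (a - b) ≡ b - a
    neg = solve-∀
    telescope : ∀ a b c → a - b + (b - c) ≡ a - c
    telescope = solve-∀
  class : Vec n → Fin (residueCount e)
  class y = residues e (y · q)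
  class-rep : ∀ c → ∃ λ y → class y ≡ c
  class-rep c with y , h ← residues-surjective e c =
    y · q′ , trans (residues-cong e (λ i → subst (ℤ.+ suc (e i) ∣_)
      (sym (ℤ.i≡j⇒i-j≡0 (inv-mat-· (Q D) y i))) (divides 0ℤ refl))) h
  -- `F` permutes the finitely many classes modulo `Lk`, being onto on them; as `x · F` lies in the
  -- class of zero, which is also the class of `0v · F`, so does `x`.
  x∈Lk : Lk x
  x∈Lk = Lk-resp {x ⊖ 0v} (λ i → ℤ.+-identityʳ (x i))
    (surjective⇒injective isEq class
      (λ {y} {z} h → residues-cong e (λ i → subst (ℤ.+ suc (e i) ∣_) (·-⊖ y z q i) (h i)))
      (λ {y} {z} h i → subst (ℤ.+ suc (e i) ∣_) (sym (·-⊖ y z q i)) (residues-injective e h i))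
      class-rep
      (_· F) (λ {y} {z} h → Lk-resp (·-⊖ y z F) (Lk-F {y ⊖ z} h))
      (λ y → proj₁ (onto y) , span⇒Lk (proj₂ (onto y)))
      {x} {0v}
      (span⇒Lk (span-⊖ {R = N} xF∈ (span-· {R = N} {N} F invariant {0v} (span-zero {R = N})))))

-- Surjections between groups `ℤⁿ` modulo a row span

record Epi {n} (N M : Mat n n) : Set where
  field
    hom      : Mat n n
    preserve : ∀ {x} → InSpan N x → InSpan M (x · hom)
    onto     : ∀ y → ∃ λ x → InSpan M ((x · hom) ⊖ y)

open Epi

Epi-trans : ∀ {n} {N M L : Mat n n} → Epi N M → Epi M L → Epi N L
Epi-trans {N = N} {M} {L} f g = record
  { hom = hom f ⊗ hom g
  ; preserve = λ {x} p → span-resp {R = L} (·-assoc x (hom f) (hom g)) (preserve g {x · hom f} (preserve f {x} p))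
  ; onto = λ z →
      let y , q = onto g z
          x , p = onto f y
      in x , span-resp {R = L} (λ i → begin
           (((x · hom f) ⊖ y) · hom g) i + ((y · hom g) i - z i)
             ≡⟨ cong (_+ ((y · hom g) i - z i)) (·-⊖ (x · hom f) y (hom g) i) ⟩
           (x · hom f · hom g) i - (y · hom g) i + ((y · hom g) i - z i)
             ≡⟨ telescope ((x · hom f · hom g) i) ((y · hom g) i) (z i) ⟩
           (x · hom f · hom g) i - z i
             ≡⟨ cong (_- z i) (·-assoc x (hom f) (hom g) i) ⟩
           (x · (hom f ⊗ hom g)) i - z i ∎)
         (span-⊕ {R = L} (preserve g {(x · hom f) ⊖ y} p) q)
  }
  where
  telescope : ∀ a b c → a - b + (b - c) ≡ a - c
  telescope = solve-∀

-- In their diagonal coordinates `N` and `N ᵀ` impose the same divisibility conditions, those by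
-- `d`. The matrix `t` passes to the coordinates of `N` and back out of those of `N ᵀ`.
Epi-ᵀ : ∀ {n} (N : Mat n n) → Epi N (N ᵀ)
Epi-ᵀ N = record
  { hom = t
  ; preserve = λ {x} p → ∣⇒span D′ (λ i → subst (d D i ∣_) (sym (t-coordinates x i)) (span⇒∣ D p i))
  ; onto = λ y → y · mat (Q D′) · inv (Q D) ,
      span-resp {R = N ᵀ} (λ i → sym (ℤ.i≡j⇒i-j≡0 (t-section y i))) (span-zero {R = N ᵀ})
  }
  where
  D = diagonalise N
  D′ = diagonalise-ᵀ D
  t = mat (Q D) ⊗ inv (Q D′)
  t-coordinates : ∀ x → x · t · mat (Q D′) ≗ x · mat (Q D)
  t-coordinates x i = trans (·-congˡ (mat (Q D′)) (λ j → sym (·-assoc x (mat (Q D)) (inv (Q D′)) j)) i)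
    (inv-mat-· (Q D′) (x · mat (Q D)) i)
  t-section : ∀ y → y · mat (Q D′) · inv (Q D) · t ≗ y
  t-section y i = begin
    (z · inv (Q D) · t) i                          ≡⟨ ·-assoc (z · inv (Q D)) (mat (Q D)) (inv (Q D′)) i ⟨
    (z · inv (Q D) · mat (Q D) · inv (Q D′)) i     ≡⟨ ·-congˡ (inv (Q D′)) (inv-mat-· (Q D) z) i ⟩
    (z · inv (Q D′)) i                             ≡⟨ mat-inv-· (Q D′) y i ⟩
    y i                                            ∎
    where z = y · mat (Q D′)

-- Followed by the surjection back, `f` becomes a surjective endomorphism of the group of `N`. If
-- `f` kills `x`, so does this composite, and the Hopfian property applies.
Epi-injective : ∀ {n} {N M : Mat n n} (f : Epi N M) → Epi M N →
  ∀ {x} → InSpan M (x · hom f) → InSpan N x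
Epi-injective {N = N} f g {x} p =
  hopfian N (hom gf) (λ i → preserve gf {N i} (span-row N i)) (onto gf) {x}
    (span-resp {R = N} (·-assoc x (hom f) (hom g)) (preserve g {x · hom f} p))
  where gf = Epi-trans f g

-- The inverse takes chosen preimages under `f`, so it is not linear on the nose. Each of its laws
-- is checked after applying `f` and then pulled back by injectivity (`reflect`). The second
-- surjection serves only to give this injectivity.
Epi-antisym : ∀ {n} {N M : Mat n n} → Epi N M → Epi M N → PresIso N M
Epi-antisym {n} {N} {M} f g = record
  { to        = to
  ; from      = from
  ; to-cong   = λ x y p → span-resp {R = M} (·-⊖ x y (hom f)) (preserve f {x ⊖ y} p)
  ; from-cong = λ x y p → reflect (λ i → begin
      to (from x) i - x i + (x i - y i) - (to (from y) i - y i)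
        ≡⟨ cong-identity (to (from x) i) (x i) (y i) (to (from y) i) ⟩
      to (from x) i - to (from y) i
        ≡⟨ ·-⊖ (from x) (from y) (hom f) i ⟨
      to (from x ⊖ from y) i ∎)
      (span-⊖ {R = M} {(to (from x) ⊖ x) ⊕ (x ⊖ y)} (span-⊕ {R = M} (to-from x) p) (to-from y))
  ; to-hom    = λ x y → span-resp {R = M}
      (λ i → sym (ℤ.i≡j⇒i-j≡0 (·-⊕ x y (hom f) i))) (span-zero {R = M})
  ; from-hom  = λ x y → reflect (λ i → begin
      to (from (x ⊕ y)) i - (x i + y i) - ((to (from x) i - x i) + (to (from y) i - y i))
        ≡⟨ hom-identity (to (from (x ⊕ y)) i) (to (from x) i) (to (from y) i) (x i) (y i) ⟩
      to (from (x ⊕ y)) i - (to (from x) i + to (from y) i)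
        ≡⟨ cong (λ w → to (from (x ⊕ y)) i - w) (·-⊕ (from x) (from y) (hom f) i) ⟨
      to (from (x ⊕ y)) i - to (from x ⊕ from y) i
        ≡⟨ ·-⊖ (from (x ⊕ y)) (from x ⊕ from y) (hom f) i ⟨
      to (from (x ⊕ y) ⊖ (from x ⊕ from y)) i ∎)
      (span-⊖ {R = M} {to (from (x ⊕ y)) ⊖ (x ⊕ y)} {(to (from x) ⊖ x) ⊕ (to (from y) ⊖ y)}
        (to-from (x ⊕ y)) (span-⊕ {R = M} (to-from x) (to-from y)))
  ; from-to   = λ x → reflect (λ i → sym (·-⊖ (from (to x)) x (hom f) i)) (to-from (to x))
  ; to-from   = to-from
  }
  where
  to from : Vec n → Vec n
  to x = x · hom f
  from y = proj₁ (onto f y)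
  to-from : ∀ y → InSpan M (to (from y) ⊖ y)
  to-from y = proj₂ (onto f y)
  reflect : ∀ {x y} → y ≗ to x → InSpan M y → InSpan N x
  reflect {x} e p = Epi-injective f g {x} (span-resp {R = M} e p)
  cong-identity : ∀ a x y b → a - x + (x - y) - (b - y) ≡ a - b
  cong-identity = solve-∀
  hom-identity : ∀ c a b x y → c - (x + y) - ((a - x) + (b - y)) ≡ c - (a + b)
  hom-identity = solve-∀

PresIso-resp : ∀ {n m m′ k k′} {R : Mat m n} {R′ : Mat m′ n} {S : Mat k n} {S′ : Mat k′ n} →
  (∀ {x} → InSpan R x → InSpan R′ x) → (∀ {x} → InSpan R′ x → InSpan R x) →
  (∀ {x} → InSpan S x → InSpan S′ x) → (∀ {x} → InSpan S′ x → InSpan S x) →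
  PresIso R S → PresIso R′ S′
PresIso-resp R⊆ R⊇ S⊆ S⊇ iso = record
  { to        = I.to
  ; from      = I.from
  ; to-cong   = λ x y p → S⊆ {I.to x ⊖ I.to y} (I.to-cong x y (R⊇ {x ⊖ y} p))
  ; from-cong = λ x y p → R⊆ {I.from x ⊖ I.from y} (I.from-cong x y (S⊇ {x ⊖ y} p))
  ; to-hom    = λ x y → S⊆ {I.to (x ⊕ y) ⊖ (I.to x ⊕ I.to y)} (I.to-hom x y)
  ; from-hom  = λ x y → R⊆ {I.from (x ⊕ y) ⊖ (I.from x ⊕ I.from y)} (I.from-hom x y)
  ; from-to   = λ x → R⊆ {I.from (I.to x) ⊖ x} (I.from-to x)
  ; to-from   = λ y → S⊆ {I.to (I.from y) ⊖ y} (I.to-from y)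
  }
  where module I = PresIso iso

-- Coloured triangulations

unit-inverse : ∀ {m n} (f : Fin m → Fin n) (g : Fin n → Fin m) →
  (∀ x → g (f x) ≡ x) → (∀ y → f (g y) ≡ y) → ∀ x y → unit (f x) y ≡ unit (g y) x
unit-inverse f g gf fg x y with f x ≟ y
... | yes refl = sym (trans (cong (λ z → unit z x) (gf x)) (unit-diag x))
... | no  fx≢y = sym (unit-off λ gy≡x → fx≢y (trans (cong f (sym gy≡x)) (fg y)))

sum-reindex : ∀ {m n} (f : Fin m → Fin n) (g : Fin n → Fin m) →
  (∀ x → g (f x) ≡ x) → (∀ y → f (g y) ≡ y) →
  ∀ (h : Vec n) → sumFin (h ∘ f) ≡ sumFin h
sum-reindex f g gf fg h = begin
  sumFin (λ x → h (f x))                              ≡⟨ sum-cong (λ x → sym (sum-unit (f x) h)) ⟩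
  sumFin (λ x → sumFin (λ y → unit (f x) y * h y))    ≡⟨ sum-swap (λ x y → unit (f x) y * h y) ⟩
  sumFin (λ y → sumFin (λ x → unit (f x) y * h y))    ≡⟨ sum-cong (λ y → trans
    (sum-cong (λ x → cong (_* h y) (unit-inverse f g gf fg x y))) (sum-unit (g y) (λ _ → h y))) ⟩
  sumFin h                                            ∎

sum-one : ∀ n → sumFin {n} (λ _ → 1ℤ) ≡ ℤ.+ n
sum-one zero    = refl
sum-one (suc n) = cong (1ℤ +_) (sum-one n)

when : {P : Set} → Dec P → ℤ → ℤ
when P? z = if ⌊ P? ⌋ then z else 0ℤ

when-+ : {P : Set} (P? : Dec P) → ∀ a b → when P? (a + b) ≡ when P? a + when P? b
when-+ (yes _) a b = refl
when-+ (no  _) a b = refl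

record Enumeration {n} {P : Fin n → Set} (P? : Decidable P) : Set where
  field
    size     : ℕ
    el       : Fin size → Fin n
    sound    : ∀ i → P (el i)
    complete : ∀ {t} → P t → ∃ λ i → el i ≡ t
    sum-el   : ∀ g → sumFin (λ t → when (P? t) (g t)) ≡ sumFin (g ∘ el)

enumerate : ∀ {n} {P : Fin n → Set} (P? : Decidable P) → Enumeration P?
enumerate {zero}  P? = record
  { size = 0 ; el = λ () ; sound = λ () ; complete = λ { {()} } ; sum-el = λ _ → refl }
enumerate {suc n} {P} P? with P? zero in eq | enumerate (P? ∘ suc)
... | yes p | E = record
  { size = suc E.size
  ; el = el
  ; sound = λ { zero → p ; (suc i) → E.sound i }
  ; complete = complete
  ; sum-el = λ g → cong₂ _+_ (cong (λ d → when d (g zero)) eq) (E.sum-el (g ∘ suc))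
  }
  where
  module E = Enumeration E
  el : Fin (suc E.size) → Fin (suc n)
  el zero    = zero
  el (suc i) = suc (E.el i)
  complete : ∀ {t} → P t → ∃ λ i → el i ≡ t
  complete {zero}  _ = zero , refl
  complete {suc t} q = let i , e = E.complete q in suc i , cong suc e
... | no ¬p | E = record
  { size = E.size
  ; el = suc ∘ E.el
  ; sound = E.sound
  ; complete = complete
  ; sum-el = λ g → trans (cong₂ _+_ (cong (λ d → when d (g zero)) eq) (E.sum-el (g ∘ suc)))
      (ℤ.+-identityˡ _)
  }
  where
  module E = Enumeration E
  complete : ∀ {t} → P t → ∃ λ i → suc (E.el i) ≡ t
  complete {zero}  q = contradiction q ¬p
  complete {suc t} q = let i , e = E.complete q in i , cong suc e

module Geometry {nV} (T : ColouredSphereTriangulation nV) where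
  open ColouredSphereTriangulation T

  φ : Fin darts → Fin darts
  φ = σ ∘ α

  col : Fin darts → Bool
  col x = colour (face x)

  tri : Fin darts → Vec nV
  tri x = unit (vtx x) ⊕ (unit (vtx (φ x)) ⊕ unit (vtx (φ (φ x))))

  vtx-σ : ∀ x → vtx (σ x) ≡ vtx x
  vtx-σ x = sym (orbit-vtx x (σ x) (1 , refl))

  face-φ : ∀ x → face (φ x) ≡ face x
  face-φ x = sym (orbit-face x (φ x) (1 , refl))

  col-α : ∀ x → col (α x) ≡ not (col x)
  col-α x = Bool.¬-not (proper x ∘ sym)

  -- `σ x` is `φ (α x)`: it lies on the face across the edge of `x`. Thus colours alternate around a
  -- vertex.
  col-σ : ∀ x → col (σ x) ≡ not (col x)
  col-σ x = trans (cong col (cong σ (sym (α-invol x))))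
    (trans (cong colour (face-φ (α x))) (col-α x))

  orbit-cases : ∀ r {x} → SameOrbit φ r x → x ≡ r ⊎ x ≡ φ r ⊎ x ≡ φ (φ r)
  orbit-cases r (zero  , e) = inj₁ (sym e)
  orbit-cases r (suc k , e) with orbit-cases r (k , refl)
  ... | inj₁ e₀        = inj₂ (inj₁ (trans (sym e) (cong φ e₀)))
  ... | inj₂ (inj₁ e₁) = inj₂ (inj₂ (trans (sym e) (cong φ e₁)))
  ... | inj₂ (inj₂ e₂) = inj₁ (trans (sym e) (trans (cong φ e₂) (triangular r)))

  tri-φ : ∀ x → tri (φ x) ≗ tri x
  tri-φ x j = trans
    (cong (λ y → unit (vtx (φ x)) j + (unit (vtx (φ (φ x))) j + unit (vtx y) j)) (triangular x))
    (rotate (unit (vtx x) j) (unit (vtx (φ x)) j) (unit (vtx (φ (φ x))) j))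
    where
    rotate : ∀ a b c → b + (c + a) ≡ a + (b + c)
    rotate = solve-∀

  tri-face : ∀ r x → face r ≡ face x → tri x ≗ tri r
  tri-face r x e j with orbit-cases r (face-orbit r x e)
  ... | inj₁ refl        = refl
  ... | inj₂ (inj₁ refl) = tri-φ r j
  ... | inj₂ (inj₂ refl) = trans (tri-φ (φ r) j) (tri-φ r j)

  rep : Fin nF → Fin darts
  rep t = proj₁ (face-surj t)

  face-rep : ∀ t → face (rep t) ≡ t
  face-rep t = proj₂ (face-surj t)

  φ² : Fin darts → Fin darts
  φ² = φ ∘ φ

  φ²-nontrivial : ∀ x → φ² x ≢ x
  φ²-nontrivial x e = nontrivial x (trans (cong φ (sym e)) (triangular x))

  -- The face of `r` consists of `r`, `φ r` and `φ² r`, which are distinct because `φ` has order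
  -- three and no fixed points; so exactly one summand is 1 when `x` lies on that face.
  face-indicator : ∀ r x → unit (face r) (face x) ≡ unit r x + (unit (φ r) x + unit (φ² r) x)
  face-indicator r x with face r ≟ face x
  ... | no r≢x = sym (cong₂ _+_ (unit-off (r≢x ∘ cong face))
          (cong₂ _+_ (unit-off (λ e → r≢x (trans (sym (face-φ r)) (cong face e))))
                     (unit-off (λ e → r≢x (trans (sym (trans (face-φ (φ r)) (face-φ r))) (cong face e))))))
  ... | yes r∼x with orbit-cases r (face-orbit r x r∼x)
  ...   | inj₁ refl        = sym (cong₂ _+_ (unit-diag r)
          (cong₂ _+_ (unit-off (nontrivial r)) (unit-off (φ²-nontrivial r))))
  ...   | inj₂ (inj₁ refl) = sym (cong₂ _+_ (unit-off (nontrivial r ∘ sym))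
          (cong₂ _+_ (unit-diag (φ r)) (unit-off (nontrivial (φ r)))))
  ...   | inj₂ (inj₂ refl) = sym (cong₂ _+_ (unit-off (φ²-nontrivial r ∘ sym))
          (cong₂ _+_ (unit-off (nontrivial (φ r) ∘ sym)) (unit-diag (φ² r))))

  sum-darts : ∀ (h : Vec darts) →
    sumFin h ≡ sumFin (λ t → h (rep t) + (h (φ (rep t)) + h (φ² (rep t))))
  sum-darts h = begin
    sumFin h
      ≡⟨ sum-cong (λ x → sym (sum-unit (face x) (λ _ → h x))) ⟩
    sumFin (λ x → sumFin (λ t → unit (face x) t * h x))
      ≡⟨ sum-swap (λ x t → unit (face x) t * h x) ⟩
    sumFin (λ t → sumFin (λ x → unit (face x) t * h x))
      ≡⟨ sum-cong (λ t → trans (sum-cong (expand t)) (three t)) ⟩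
    sumFin (λ t → h (rep t) + (h (φ (rep t)) + h (φ² (rep t)))) ∎
    where
    indicator : ∀ t x → unit (face x) t ≡ unit (rep t) x + (unit (φ (rep t)) x + unit (φ² (rep t)) x)
    indicator t x = trans (unit-sym (face x) t)
      (trans (cong (λ s → unit s (face x)) (sym (face-rep t))) (face-indicator (rep t) x))
    distrib : ∀ a b c d → (a + (b + c)) * d ≡ a * d + (b * d + c * d)
    distrib = solve-∀
    part : Fin darts → Vec darts
    part r x = unit r x * h x
    expand : ∀ t x → unit (face x) t * h x ≡
      part (rep t) x + (part (φ (rep t)) x + part (φ² (rep t)) x)
    expand t x = trans (cong (_* h x) (indicator t x))
      (distrib (unit (rep t) x) (unit (φ (rep t)) x) (unit (φ² (rep t)) x) (h x))
    three : ∀ t → sumFin (part (rep t) ⊕ (part (φ (rep t)) ⊕ part (φ² (rep t)))) ≡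
                  h (rep t) + (h (φ (rep t)) + h (φ² (rep t)))
    three t = trans (sum-+ (part (rep t)) (part (φ (rep t)) ⊕ part (φ² (rep t))))
      (cong₂ _+_ (sum-unit (rep t) h)
        (trans (sum-+ (part (φ (rep t))) (part (φ² (rep t))))
               (cong₂ _+_ (sum-unit (φ (rep t)) h) (sum-unit (φ² (rep t)) h))))

  faces : ∀ b → Enumeration (λ t → colour t Bool.≟ b)
  faces b = enumerate (λ t → colour t Bool.≟ b)

  module Faces b = Enumeration (faces b)

  colourSum : Bool → Vec darts → ℤ
  colourSum b s = sumFin (λ x → when (col x Bool.≟ b) (s x))

  colourSum-faces : ∀ b (s : Vec darts) → colourSum b s ≡
    sumFin (λ i → let r = rep (Faces.el b i) in s r + (s (φ r) + s (φ² r)))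
  colourSum-faces b s = begin
    sumFin h
      ≡⟨ sum-darts h ⟩
    sumFin (λ t → h (rep t) + (h (φ (rep t)) + h (φ² (rep t))))
      ≡⟨ sum-cong same-colour ⟩
    sumFin (λ t → when (colour t Bool.≟ b) (s (rep t) + (s (φ (rep t)) + s (φ² (rep t)))))
      ≡⟨ Faces.sum-el b (λ t → s (rep t) + (s (φ (rep t)) + s (φ² (rep t)))) ⟩
    sumFin (λ i → let r = rep (Faces.el b i) in s r + (s (φ r) + s (φ² r))) ∎
    where
    h : Vec darts
    h x = when (col x Bool.≟ b) (s x)
    recolour : ∀ {t} x → face x ≡ t → h x ≡ when (colour t Bool.≟ b) (s x)
    recolour x refl = refl
    same-colour : ∀ t → h (rep t) + (h (φ (rep t)) + h (φ² (rep t))) ≡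
      when (colour t Bool.≟ b) (s (rep t) + (s (φ (rep t)) + s (φ² (rep t))))
    same-colour t = trans
      (cong₂ _+_ (recolour (rep t) (face-rep t))
        (cong₂ _+_ (recolour (φ (rep t)) (trans (face-φ (rep t)) (face-rep t)))
                   (recolour (φ² (rep t)) (trans (face-φ (φ (rep t))) (trans (face-φ (rep t)) (face-rep t))))))
      (sym (trans (when-+ (colour t Bool.≟ b) (s (rep t)) _)
        (cong (_+_ (when (colour t Bool.≟ b) (s (rep t))))
              (when-+ (colour t Bool.≟ b) (s (φ (rep t))) (s (φ² (rep t)))))))

  -- Reindexing along the bijection `f` carries the darts of colour `b` to those of the other
  -- colour.
  colourSum-flip : ∀ b (f g : Fin darts → Fin darts) →
    (∀ x → g (f x) ≡ x) → (∀ y → f (g y) ≡ y) → (∀ x → col (f x) ≡ not (col x)) →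
    (s : Vec darts) → (∀ x → s (f x) ≡ s x) → colourSum b s ≡ colourSum (not b) s
  colourSum-flip b f g gf fg flips s invariant = trans (sum-cong pointwise)
    (sum-reindex f g gf fg (λ x → when (col x Bool.≟ not b) (s x)))
    where
    when-not : ∀ a b z → when (a Bool.≟ b) z ≡ when (not a Bool.≟ not b) z
    when-not false false z = refl
    when-not false true  z = refl
    when-not true  false z = refl
    when-not true  true  z = refl
    pointwise : ∀ x → when (col x Bool.≟ b) (s x) ≡ when (col (f x) Bool.≟ not b) (s (f x))
    pointwise x = trans (when-not (col x) b (s x))
      (cong₂ (λ c z → when (c Bool.≟ not b) z) (sym (flips x)) (sym (invariant x)))

  -- Multiplying out a product of two triangle vectors gives one `loop` term per corner and one
  -- `cross` term per side. A corner term depends only on the vertex, so it is invariant under `σ`;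
  -- a side term depends only on the edge, so it is invariant under `α`. Both permutations reverse
  -- colours.
  gram : ∀ b u v →
    sumFin (λ i → tri (rep (Faces.el b i)) u * tri (rep (Faces.el b i)) v) ≡
    sumFin (λ i → tri (rep (Faces.el (not b) i)) u * tri (rep (Faces.el (not b) i)) v)
  gram b u v = begin
    sumFin (λ i → tri (rep (Faces.el b i)) u * tri (rep (Faces.el b i)) v)
      ≡⟨ as-colourSums b ⟩
    colourSum b loop + colourSum b cross
      ≡⟨ cong₂ _+_ (colourSum-flip b σ σ⁻¹ σ-left σ-right col-σ loop loop-σ)
                   (colourSum-flip b α α α-invol α-invol col-α cross cross-α) ⟩
    colourSum (not b) loop + colourSum (not b) cross
      ≡⟨ as-colourSums (not b) ⟨
    sumFin (λ i → tri (rep (Faces.el (not b) i)) u * tri (rep (Faces.el (not b) i)) v) ∎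
    where
    e : Fin darts → Vec nV
    e x = unit (vtx x)
    loop cross both : Vec darts
    loop x = e x u * e x v
    cross x = e x u * e (φ x) v + e (φ x) u * e x v
    both x = loop x + cross x
    loop-σ : ∀ x → loop (σ x) ≡ loop x
    loop-σ x = cong (λ w → unit w u * unit w v) (vtx-σ x)
    cross-α : ∀ x → cross (α x) ≡ cross x
    cross-α x = begin
      cross (α x)
        ≡⟨ cong₂ (λ y z → unit y u * unit z v + unit z u * unit y v)
             (sym (vtx-σ (α x))) (trans (vtx-σ (α (α x))) (cong vtx (α-invol x))) ⟩
      e (φ x) u * e x v + e x u * e (φ x) v
        ≡⟨ ℤ.+-comm (e (φ x) u * e x v) (e x u * e (φ x) v) ⟩
      cross x ∎
    expand : ∀ a b c a′ b′ c′ → (a + (b + c)) * (a′ + (b′ + c′)) ≡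
      (a * a′ + (a * b′ + b * a′)) + ((b * b′ + (b * c′ + c * b′)) + (c * c′ + (c * a′ + a * c′)))
    expand = solve-∀
    tri-tri : ∀ r → tri r u * tri r v ≡ both r + (both (φ r) + both (φ² r))
    tri-tri r = trans
      (expand (e r u) (e (φ r) u) (e (φ² r) u) (e r v) (e (φ r) v) (e (φ² r) v))
      -- The corner after `φ² r` is `r` again, so the last group of terms is `both (φ² r)`.
      (cong (λ z → both r + (both (φ r) + (loop (φ² r) + (e (φ² r) u * e z v + e z u * e (φ² r) v))))
            (sym (triangular r)))
    as-colourSums : ∀ b → sumFin (λ i → tri (rep (Faces.el b i)) u * tri (rep (Faces.el b i)) v) ≡
      colourSum b loop + colourSum b cross
    as-colourSums b = begin
      sumFin (λ i → tri (rep (Faces.el b i)) u * tri (rep (Faces.el b i)) v)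
        ≡⟨ sum-cong (λ i → tri-tri (rep (Faces.el b i))) ⟩
      sumFin (λ i → let r = rep (Faces.el b i) in both r + (both (φ r) + both (φ² r)))
        ≡⟨ colourSum-faces b both ⟨
      colourSum b both
        ≡⟨ sum-cong (λ x → when-+ (col x Bool.≟ b) (loop x) (cross x)) ⟩
      sumFin (λ x → when (col x Bool.≟ b) (loop x) + when (col x Bool.≟ b) (cross x))
        ≡⟨ sum-+ (λ x → when (col x Bool.≟ b) (loop x)) (λ x → when (col x Bool.≟ b) (cross x)) ⟩
      colourSum b loop + colourSum b cross ∎

-- Counting faces and vertices

module Counting {nV} (T : ColouredSphereTriangulation nV) where
  open ColouredSphereTriangulation T
  open Geometry T

  sum-three : ∀ n → sumFin {n} (λ _ → ℤ.+ 3) ≡ ℤ.+ (3 ℕ.* n)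
  sum-three n = begin
    sumFin {n} (λ _ → ℤ.+ 3 * 1ℤ)  ≡⟨ sum-*ˡ {n} (ℤ.+ 3) (λ _ → 1ℤ) ⟩
    ℤ.+ 3 * sumFin {n} (λ _ → 1ℤ)  ≡⟨ cong (ℤ.+ 3 *_) (sum-one n) ⟩
    ℤ.+ 3 * ℤ.+ n                  ≡⟨ ℤ.pos-* 3 n ⟨
    ℤ.+ (3 ℕ.* n)                  ∎

  -- Three times the number of faces of a colour is the number of darts of that colour, and `α`
  -- exchanges the darts of the two colours.
  size-flip : ∀ b → Faces.size b ≡ Faces.size (not b)
  size-flip b = ℕ.*-cancelˡ-≡ _ _ 3 (ℤ.+-injective (begin
    ℤ.+ (3 ℕ.* Faces.size b)        ≡⟨ sum-three (Faces.size b) ⟨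
    sumFin {Faces.size b} (λ _ → ℤ.+ 3)  ≡⟨ colourSum-faces b (λ _ → 1ℤ) ⟨
    colourSum b (λ _ → 1ℤ)          ≡⟨ colourSum-flip b α α α-invol α-invol col-α (λ _ → 1ℤ) (λ _ → refl) ⟩
    colourSum (not b) (λ _ → 1ℤ)    ≡⟨ colourSum-faces (not b) (λ _ → 1ℤ) ⟩
    sumFin {Faces.size (not b)} (λ _ → ℤ.+ 3)  ≡⟨ sum-three (Faces.size (not b)) ⟩
    ℤ.+ (3 ℕ.* Faces.size (not b))  ∎))

  darts≡3nF : darts ≡ 3 ℕ.* nF
  darts≡3nF = ℤ.+-injective (trans (sym (sum-one darts)) (trans (sum-darts (λ _ → 1ℤ)) (sum-three nF)))

  nF≡sizes : nF ≡ Faces.size true ℕ.+ Faces.size false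
  nF≡sizes = ℤ.+-injective (begin
    ℤ.+ nF
      ≡⟨ sum-one nF ⟨
    sumFin {nF} (λ _ → 1ℤ)
      ≡⟨ sum-cong (λ t → either (colour t)) ⟩
    sumFin (λ t → when (colour t Bool.≟ true) 1ℤ + when (colour t Bool.≟ false) 1ℤ)
      ≡⟨ sum-+ (λ t → when (colour t Bool.≟ true) 1ℤ) (λ t → when (colour t Bool.≟ false) 1ℤ) ⟩
    sumFin (λ t → when (colour t Bool.≟ true) 1ℤ) + sumFin (λ t → when (colour t Bool.≟ false) 1ℤ)
      ≡⟨ cong₂ _+_ (count true) (count false) ⟩
    ℤ.+ (Faces.size true ℕ.+ Faces.size false) ∎)
    where
    either : ∀ c → 1ℤ ≡ when (c Bool.≟ true) 1ℤ + when (c Bool.≟ false) 1ℤ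
    either true  = refl
    either false = refl
    count : ∀ b → sumFin (λ t → when (colour t Bool.≟ b) 1ℤ) ≡ ℤ.+ Faces.size b
    count b = trans (Faces.sum-el b (λ _ → 1ℤ)) (sum-one (Faces.size b))

  -- With `k` faces of each colour there are `2k` faces and `6k` darts, and Euler's formula reads
  -- `2 nV + 4k = 6k + 4`. This is where genus 0 enters.
  nV≡2+size : nV ≡ 2 ℕ.+ Faces.size true
  nV≡2+size = ℕ.*-cancelˡ-≡ _ _ 2 (ℕ.+-cancelʳ-≡ (2 ℕ.* (k ℕ.+ k)) _ _ (begin
    2 ℕ.* nV ℕ.+ 2 ℕ.* (k ℕ.+ k)         ≡⟨ cong (λ n → 2 ℕ.* nV ℕ.+ 2 ℕ.* n) nF≡2k ⟨
    2 ℕ.* nV ℕ.+ 2 ℕ.* nF                ≡⟨ euler ⟩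
    darts ℕ.+ 4                          ≡⟨ cong (ℕ._+ 4) (trans darts≡3nF (cong (3 ℕ.*_) nF≡2k)) ⟩
    3 ℕ.* (k ℕ.+ k) ℕ.+ 4                ≡⟨ rearrange k ⟩
    2 ℕ.* (2 ℕ.+ k) ℕ.+ 2 ℕ.* (k ℕ.+ k)  ∎))
    where
    k = Faces.size true
    nF≡2k : nF ≡ k ℕ.+ k
    nF≡2k = trans nF≡sizes (cong (k ℕ.+_) (sym (size-flip true)))
    rearrange : ∀ k → 3 ℕ.* (k ℕ.+ k) ℕ.+ 4 ≡ 2 ℕ.* (2 ℕ.+ k) ℕ.+ 2 ℕ.* (k ℕ.+ k)
    rearrange = ℕ-solve-∀

-- One dart on each face; there are k faces of either colour.
record FaceDarts {nV} (T : ColouredSphereTriangulation nV) (k : ℕ) : Set where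
  open ColouredSphereTriangulation T
  open Geometry T
  field
    dart      : Bool → Fin k → Fin darts
    sound     : ∀ b i → col (dart b i) ≡ b
    complete  : ∀ x → ∃ λ i → face (dart (col x) i) ≡ face x
    dart-gram : ∀ b u v → sumFin (λ i → tri (dart b i) u * tri (dart b i) v) ≡
                          sumFin (λ i → tri (dart (not b) i) u * tri (dart (not b) i) v)

sum-subst : ∀ {m n} (e : m ≡ n) (f : Vec n) → sumFin (f ∘ subst Fin e) ≡ sumFin f
sum-subst refl f = refl

faceDarts : ∀ {nV} (T : ColouredSphereTriangulation nV) →
  ∃ λ k → nV ≡ 2 ℕ.+ k × FaceDarts T k
faceDarts T = Faces.size true , nV≡2+size , record
  { dart = λ b i → dart b (subst Fin (size≡ b) i)
  ; sound = λ b i → trans (cong colour (face-rep _)) (Faces.sound b (subst Fin (size≡ b) i))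
  ; complete = λ x → let i , e = Faces.complete (col x) {face x} refl in
      subst Fin (sym (size≡ (col x))) i ,
      trans (cong (face ∘ dart (col x)) (subst-subst-sym (size≡ (col x)))) (trans (face-rep _) e)
  ; dart-gram = λ b u v → trans (sum-subst (size≡ b) (product b u v))
      (trans (gram b u v) (sym (sum-subst (size≡ (not b)) (product (not b) u v))))
  }
  where
  open ColouredSphereTriangulation T
  open Geometry T
  open Counting T
  dart : ∀ b → Fin (Faces.size b) → Fin darts
  dart b i = rep (Faces.el b i)
  product : ∀ b u v → Vec (Faces.size b)
  product b u v i = tri (dart b i) u * tri (dart b i) v
  size≡ : ∀ b → Faces.size true ≡ Faces.size b
  size≡ true  = refl
  size≡ false = size-flip true

-- The square relation matrices and the surjection between the colours

module Presentation {k} (T : ColouredSphereTriangulation (2 ℕ.+ k)) (S : FaceDarts T k) where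
  open ColouredSphereTriangulation T
  open Geometry T
  open FaceDarts S

  rels : Bool → Mat (2 ℕ.+ k) (2 ℕ.+ k)
  rels b zero          = 0v
  rels b (suc zero)    = 0v
  rels b (suc (suc i)) = tri (dart b i)

  base : Fin darts
  base = proj₁ (vtx-surj zero)

  -- Row by row, the images of the generators of the group of `rels b ᵀ`. A zero row of `rels b` is
  -- a zero column of the transpose, so the first two generators are free and may be sent anywhere;
  -- `vtx (φ base)` is the far end of the dart `base`.
  gens : Bool → Mat (2 ℕ.+ k) (2 ℕ.+ k)
  gens b zero          = unit (vtx base)
  gens b (suc zero)    = unit (vtx (φ base))
  gens b (suc (suc i)) = tri (dart b i)

  -- The two extra generators have coefficient zero in every relation, so what remains is row `v` of
  -- the Gram matrix. Rewritten in the other colour, it is the sum of the relations of the triangles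
  -- at `v`.
  gens-star : ∀ b v → InSpan (rels (not b)) ((rels b ᵀ) v · gens b)
  gens-star b v = (rels (not b) ᵀ) v , λ u →
    cong₂ _+_ (ℤ.*-zeroˡ (gens b zero u)) (cong₂ _+_ (ℤ.*-zeroˡ (gens b (suc zero) u)) (dart-gram b v u))

  Generated : Bool → Vec (2 ℕ.+ k) → Set
  Generated b z = ∃ λ y → InSpan (rels (not b)) ((y · gens b) ⊖ z)

  module _ (b : Bool) where

    R : Mat (2 ℕ.+ k) (2 ℕ.+ k)
    R = rels (not b)

    G : Mat (2 ℕ.+ k) (2 ℕ.+ k)
    G = gens b

    generated-resp : ∀ {z w} → z ≗ w → Generated b z → Generated b w
    generated-resp z≗w (y , p) =
      y , span-resp {R = R} (λ i → cong (λ a → (y · G) i - a) (z≗w i)) p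

    generated-⊕ : ∀ {z w} → Generated b z → Generated b w → Generated b (z ⊕ w)
    generated-⊕ {z} {w} (y , p) (y′ , p′) = (y ⊕ y′) , span-resp {R = R}
      (λ i → trans (interchange ((y · G) i) (z i) ((y′ · G) i) (w i))
                   (cong (_- (z i + w i)) (sym (·-⊕ y y′ G i))))
      (span-⊕ {R = R} p p′)
      where
      interchange : ∀ a b c d → a - b + (c - d) ≡ a + c - (b + d)
      interchange = solve-∀

    generated-scale : ∀ a {z} → Generated b z → Generated b (scale a z)
    generated-scale a {z} (y , p) = scale a y , span-resp {R = R}
      (λ i → trans (distrib a ((y · G) i) (z i)) (cong (_- a * z i) (sym (·-scale a y G i))))
      (span-scale {R = R} a p)
      where
      distrib : ∀ a b c → a * (b - c) ≡ a * b - a * c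
      distrib = solve-∀

    generated-⊖ : ∀ {z w} → Generated b z → Generated b w → Generated b (z ⊖ w)
    generated-⊖ {z} {w} p q = generated-resp (λ i → sym (⊖-scale z w i))
      (generated-⊕ p (generated-scale -1ℤ {w} q))

    generated-gen : ∀ i → Generated b (G i)
    generated-gen i = unit i , span-resp {R = R}
      (λ j → sym (ℤ.i≡j⇒i-j≡0 (sum-unit i (λ l → G l j)))) (span-zero {R = R})

    generated-rel : ∀ {z} → InSpan R z → Generated b z
    generated-rel {z} p = 0v , span-⊖ {R = R} zero∈ p
      where
      zero∈ : InSpan R (0v · G)
      zero∈ = span-resp {R = R}
        (λ j → sym (trans (sum-cong (λ l → ℤ.*-zeroˡ (G l j))) (sum-zero (2 ℕ.+ k)))) (span-zero {R = R})

    generated-· : ∀ {m} (c : Vec m) (A : Mat m (2 ℕ.+ k)) →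
      (∀ i → Generated b (A i)) → Generated b (c · A)
    generated-· {zero}  c A h = generated-rel (span-zero {R = R})
    generated-· {suc m} c A h =
      generated-⊕ (generated-scale (c zero) (h zero)) (generated-· (c ∘ suc) (A ∘ suc) (h ∘ suc))

    -- A triangle of colour `b` is the image of a generator, and one of the other colour is zero in
    -- the target.
    generated-tri : ∀ x → Generated b (tri x)
    generated-tri x with i , e ← complete x with col x Bool.≟ b
    ... | yes refl = generated-resp (λ j → sym (tri-face (dart (col x) i) x e j))
                       (generated-gen (suc (suc i)))
    ... | no  c≢b  = generated-resp (λ j → sym (tri-face (dart (col x) i) x e j))
                       (generated-rel (subst (λ c → InSpan R (tri (dart c i))) (sym (Bool.¬-not c≢b))
                         (span-row R (suc (suc i)))))

    -- The induction needs both ends of the current dart. `α` exchanges them. For `σ`, the darts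
    -- `α y` and `σ y` lie on a common triangle whose first two vertices are the ends of `y`;
    -- subtracting these from the triangle leaves the far end of `σ y`.
    generated-dart : ∀ {x} → Reach σ α base x →
      Generated b (unit (vtx x)) × Generated b (unit (vtx (φ x)))
    generated-dart here = generated-gen zero , generated-gen (suc zero)
    generated-dart (stepα {y} r) with p , q ← generated-dart r =
      subst (Generated b ∘ unit) (vtx-σ (α y)) q ,
      subst (Generated b ∘ unit) (sym (trans (vtx-σ (α (α y))) (cong vtx (α-invol y)))) p
    generated-dart (stepσ {y} r) with p , q ← generated-dart r =
      at-σ ,
      generated-resp
        (λ j → solution (unit (vtx (α y)) j) (unit (vtx (σ y)) j) (unit (vtx (φ (σ y))) j))
        (generated-⊖ (generated-⊖ triangle (subst (Generated b ∘ unit) (vtx-σ (α y)) q)) at-σ)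
      where
      triangle : Generated b (unit (vtx (α y)) ⊕ (unit (vtx (σ y)) ⊕ unit (vtx (φ (σ y)))))
      triangle = subst (λ z → Generated b (unit (vtx (α y)) ⊕ (unit (vtx z) ⊕ unit (vtx (φ z)))))
        (cong σ (α-invol y)) (generated-tri (α y))
      at-σ : Generated b (unit (vtx (σ y)))
      at-σ = subst (Generated b ∘ unit) (sym (vtx-σ y)) (proj₁ (generated-dart r))
      solution : ∀ a b c → a + (b + c) - a - b ≡ c
      solution = solve-∀

    generated : ∀ z → Generated b z
    generated z = generated-resp (·-identityʳ z) (generated-· z unit λ v →
      subst (Generated b ∘ unit) (proj₂ (vtx-surj v))
        (proj₁ (generated-dart (connected base (proj₁ (vtx-surj v))))))

    star-epi : Epi (rels b ᵀ) (rels (not b))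
    star-epi = record
      { hom = G
      ; preserve = λ {x} → span-· {R = rels b ᵀ} {R} G (gens-star b) {x}
      ; onto = generated
      }

    flip-epi : Epi (rels b) (rels (not b))
    flip-epi = Epi-trans (Epi-ᵀ (rels b)) star-epi

    rels⊆triangleRel : ∀ {x} → InSpan (rels b) x → InSpan (triangleRel T b) x
    rels⊆triangleRel {x} = span-⊆ {R = rels b} {triangleRel T b} row {x}
      where
      row : ∀ i → InSpan (triangleRel T b) (rels b i)
      row zero          = span-zero {R = triangleRel T b}
      row (suc zero)    = span-zero {R = triangleRel T b}
      row (suc (suc i)) = span-resp {R = triangleRel T b} (λ j → cong (λ v → v j) coloured)
                            (span-row (triangleRel T b) (dart b i))
        where
        coloured : triangleRel T b (dart b i) ≡ tri (dart b i)
        coloured with col (dart b i) Bool.≟ b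
        ... | yes _  = refl
        ... | no c≢b = contradiction (sound b i) c≢b

    triangleRel⊆rels : ∀ {x} → InSpan (triangleRel T b) x → InSpan (rels b) x
    triangleRel⊆rels {x} = span-⊆ {R = triangleRel T b} {rels b} row {x}
      where
      row : ∀ x → InSpan (rels b) (triangleRel T b x)
      row x with col x Bool.≟ b
      ... | no  _    = span-zero {R = rels b}
      ... | yes refl with i , e ← complete x =
            span-resp {R = rels b} (λ j → sym (tri-face (dart (col x) i) x e j))
              (span-row (rels b) (suc (suc i)))

  presIso : PresIso (whiteRels T) (blackRels T)
  presIso = PresIso-resp {R = rels true} {whiteRels T} {rels false} {blackRels T}
    (λ {x} → rels⊆triangleRel true {x}) (λ {x} → triangleRel⊆rels true {x})
    (λ {x} → rels⊆triangleRel false {x}) (λ {x} → triangleRel⊆rels false {x})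
    (Epi-antisym (flip-epi true) (flip-epi false))

-- With `nV` and `k` still variables, the equation can be matched with `refl`, which makes the
-- relation matrices square by type.
faceDarts⇒presIso : ∀ {nV} (T : ColouredSphereTriangulation nV) →
  (∃ λ k → nV ≡ 2 ℕ.+ k × FaceDarts T k) → PresIso (whiteRels T) (blackRels T)
faceDarts⇒presIso T (k , refl , S) = Presentation.presIso T S

theorem1 : (nV : ℕ) (T : ColouredSphereTriangulation nV) →
    PresIso (whiteRels T) (blackRels T)
theorem1 nV T = faceDarts⇒presIso T (faceDarts T)
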